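{- Let $m$ be a fixed positive integer, $p=\frac12$ and $\varepsilon>0$. If $l=l(n)$ is a sequence of integers with $l\le \left(1-\frac{\varepsilon}{m}\right)\log_2 n$, then asymptotically almost surely $\tilde H_{l-2}(N_m(G(n,p)))=0$.
   Context: $G(n,p)$ is the Erdős–Rényi random graph on $n$ vertices in which each edge appears independently with probability $p$. For a graph $G$ and a nonnegative integer $m$, the multineighbor complex $N_m(G)$ is the simplicial complex in which a set of $q+1$ vertices of $G$ ($q\ge 0$) is a $q$-simplex if and only if these vertices have at least $m$ common neighbors in $G$. $\tilde H_*$ denotes reduced simplicial homology with integer coefficients. A property holds asymptotically almost surely (a.a.s.) if its probability tends to $1$ as $n\to\infty$. -}

module Defs where

open import Level using (0ℓ)
open import Algebra.Bundles using (AbelianGroup)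
open import Data.Bool.Base using (Bool; true; false; if_then_else_; T)
open import Data.Empty using (⊥-elim)
open import Data.Fin.Base using (Fin; zero; suc)
open import Data.Fin.Properties using (all?)
open import Data.Fin.Subset using (Subset; Side; inside; outside; Nonempty; _⊆_; _∈_; ∣_∣)
open import Data.Fin.Subset.Properties using (_∈?_)
open import Data.Integer.Base as ℤ using (ℤ; +_; 0ℤ; 1ℤ)
import Data.Integer.Properties as ℤ
open import Data.Integer.Solver using () renaming (module +-*-Solver to ℤS)
open import Data.List.Base as List using (List; []; _∷_; concatMap; filterᵇ)
open import Data.Nat.Base as ℕ using (ℕ; zero; suc; NonZero; s≤s; z≤n; ⌊_/2⌋)
open import Data.Nat.Logarithm using (⌊log₂_⌋; ⌊log₂⌋-mono-≤; ⌊log₂⌊n/2⌋⌋≡⌊log₂n⌋∸1; ⌊log₂[2^n]⌋≡n)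
import Data.Nat.Properties as ℕ
open import Data.Product.Base using (_×_; _,_; proj₁; proj₂; ∃; ∃-syntax; Σ-syntax)
open import Data.Rational.Base as ℚ using (ℚ; mkℚ; 0ℚ; 1ℚ; ½; toℚᵘ)
import Data.Rational.Properties as ℚ
open import Data.Rational.Solver using (module +-*-Solver)
open import Data.Rational.Unnormalised.Base as ℚᵘ using (mkℚᵘ; *≤*; *≡*)
import Data.Rational.Unnormalised.Properties as ℚᵘ
open import Data.Sum.Base using (_⊎_; inj₁; inj₂)
open import Data.Vec.Base using (Vec; []; _∷_; lookup; tabulate; _[_]≔_)
open import Function.Base using (_∘_)
open import Relation.Binary.PropositionalEquality
  using (_≡_; refl; sym; trans; cong; cong₂; subst; subst₂; module ≡-Reasoning)
open import Relation.Nullary using (¬_; Dec; does; yes; no)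
open import Relation.Nullary.Decidable using (_→-dec_; dec-true)
open import Relation.Unary using (Pred; Decidable)
import Data.Bool.Properties as Bool
open import Algebra.Properties.CommutativeMonoid.Sum ℤ.+-0-commutativeMonoid
  using (sum; sum-syntax; ∑-distrib-+; sum-cong-≗; sum-replicate-zero)

Cauchy : (ℕ → ℚ) → Set
Cauchy x = ∀ {δ} → 0ℚ ℚ.< δ →
  ∃[ N ] (∀ {i j} → N ℕ.≤ i → N ℕ.≤ j → ℚ.∣ x i ℚ.- x j ∣ ℚ.≤ δ)

record ℝ : Set where
  constructor mkℝ
  field
    approx : ℕ → ℚ
    cauchy : Cauchy approx

open ℝ public

infix 4 _≤ᴿ_ _<ᴿ_

_≤ᴿ_ : ℝ → ℝ → Set
x ≤ᴿ y = ∀ {δ} → 0ℚ ℚ.< δ →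
  ∃[ N ] (∀ {i} → N ℕ.≤ i → approx x i ℚ.≤ approx y i ℚ.+ δ)

_<ᴿ_ : ℝ → ℝ → Set
x <ᴿ y = Σ[ δ ∈ ℚ ] 0ℚ ℚ.< δ ×
  ∃[ N ] (∀ {i} → N ℕ.≤ i → approx x i ℚ.+ δ ℚ.≤ approx y i)

fromℚ : ℚ → ℝ
fromℚ q .approx _ = q
fromℚ q .cauchy {δ} 0<δ = 0 , λ _ _ →
  subst (λ r → ℚ.∣ r ∣ ℚ.≤ δ) (sym (ℚ.+-inverseʳ q)) (ℚ.<⇒≤ 0<δ)

fromℤ : ℤ → ℝ
fromℤ z = fromℚ (z ℚ./ 1)

0ᴿ 1ᴿ : ℝ
0ᴿ = fromℚ 0ℚ
1ᴿ = fromℚ 1ℚ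

private
  half : ∀ {δ} → 0ℚ ℚ.< δ → 0ℚ ℚ.< ½ ℚ.* δ
  half {δ} 0<δ = subst (ℚ._< ½ ℚ.* δ) (ℚ.*-zeroʳ ½) (ℚ.*-monoʳ-<-pos ½ 0<δ)

  half+half : ∀ δ → ½ ℚ.* δ ℚ.+ ½ ℚ.* δ ≡ δ
  half+half δ = trans (sym (ℚ.*-distribʳ-+ δ ½ ½)) (ℚ.*-identityˡ δ)

  Cauchy-- : ∀ x y → Cauchy x → Cauchy y → Cauchy (λ i → x i ℚ.- y i)
  Cauchy-- x y cx cy {δ} 0<δ with cx (half 0<δ) | cy (half 0<δ)
  ... | M , f | N , g = M ℕ.⊔ N , λ {i} {j} p q → begin
      ℚ.∣ (x i ℚ.- y i) ℚ.- (x j ℚ.- y j) ∣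
        ≡⟨ cong ℚ.∣_∣ (solve 4 (λ a b c d → (a :- b) :- (c :- d) := (a :- c) :- (b :- d))
             refl (x i) (y i) (x j) (y j)) ⟩
      ℚ.∣ (x i ℚ.- x j) ℚ.- (y i ℚ.- y j) ∣
        ≤⟨ ℚ.∣p-q∣≤∣p∣+∣q∣ (x i ℚ.- x j) (y i ℚ.- y j) ⟩
      ℚ.∣ x i ℚ.- x j ∣ ℚ.+ ℚ.∣ y i ℚ.- y j ∣
        ≤⟨ ℚ.+-mono-≤ (f (ℕ.m⊔n≤o⇒m≤o M N p) (ℕ.m⊔n≤o⇒m≤o M N q))
                      (g (ℕ.m⊔n≤o⇒n≤o M N p) (ℕ.m⊔n≤o⇒n≤o M N q)) ⟩
      ½ ℚ.* δ ℚ.+ ½ ℚ.* δ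
        ≡⟨ half+half δ ⟩
      δ ∎
    where open ℚ.≤-Reasoning
          open +-*-Solver

  bounded : ∀ x → Cauchy x →
    Σ[ B ∈ ℚ ] 0ℚ ℚ.< B × ∃[ N ] (∀ {i} → N ℕ.≤ i → ℚ.∣ x i ∣ ℚ.≤ B)
  bounded x cx with cx (ℚ.positive⁻¹ 1ℚ)
  ... | N , f = 1ℚ ℚ.+ ℚ.∣ x N ∣
              , ℚ.+-mono-<-≤ (ℚ.positive⁻¹ 1ℚ) (ℚ.0≤∣p∣ (x N))
              , N , λ {i} p → begin
      ℚ.∣ x i ∣                       ≡⟨ cong ℚ.∣_∣ (solve 2 (λ a b → a := (a :- b) :+ b) refl (x i) (x N)) ⟩
      ℚ.∣ (x i ℚ.- x N) ℚ.+ x N ∣     ≤⟨ ℚ.∣p+q∣≤∣p∣+∣q∣ (x i ℚ.- x N) (x N) ⟩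
      ℚ.∣ x i ℚ.- x N ∣ ℚ.+ ℚ.∣ x N ∣ ≤⟨ ℚ.+-monoˡ-≤ ℚ.∣ x N ∣ (f p ℕ.≤-refl) ⟩
      1ℚ ℚ.+ ℚ.∣ x N ∣                ∎
    where open ℚ.≤-Reasoning
          open +-*-Solver

  *-mono-∣∣ : ∀ p q {a b} → 0ℚ ℚ.< a → ℚ.∣ p ∣ ℚ.≤ a → ℚ.∣ q ∣ ℚ.≤ b → ℚ.∣ p ℚ.* q ∣ ℚ.≤ a ℚ.* b
  *-mono-∣∣ p q {a} {b} 0<a p≤a q≤b = begin
      ℚ.∣ p ℚ.* q ∣       ≡⟨ ℚ.∣p*q∣≡∣p∣*∣q∣ p q ⟩
      ℚ.∣ p ∣ ℚ.* ℚ.∣ q ∣ ≤⟨ ℚ.*-monoʳ-≤-nonNeg ℚ.∣ q ∣ {{ℚ.∣-∣-nonNeg q}} p≤a ⟩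
      a ℚ.* ℚ.∣ q ∣       ≤⟨ ℚ.*-monoˡ-≤-nonNeg a {{ℚ.nonNegative (ℚ.<⇒≤ 0<a)}} q≤b ⟩
      a ℚ.* b             ∎
    where open ℚ.≤-Reasoning

  product-difference : ∀ a b c d → a ℚ.* b ℚ.- c ℚ.* d ≡ a ℚ.* (b ℚ.- d) ℚ.+ d ℚ.* (a ℚ.- c)
  product-difference a b c d = begin
      a ℚ.* b ℚ.- c ℚ.* d
        ≡⟨ solve 3 (λ u v w → u :- w := (u :- v) :+ (v :- w)) refl (a ℚ.* b) (a ℚ.* d) (c ℚ.* d) ⟩
      (a ℚ.* b ℚ.- a ℚ.* d) ℚ.+ (a ℚ.* d ℚ.- c ℚ.* d)
        ≡⟨ cong₂ (λ u v → (a ℚ.* b ℚ.- a ℚ.* d) ℚ.+ (u ℚ.- v)) (ℚ.*-comm a d) (ℚ.*-comm c d) ⟩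
      (a ℚ.* b ℚ.- a ℚ.* d) ℚ.+ (d ℚ.* a ℚ.- d ℚ.* c)
        ≡⟨ sym (cong₂ ℚ._+_ (*-distrib-- a b d) (*-distrib-- d a c)) ⟩
      a ℚ.* (b ℚ.- d) ℚ.+ d ℚ.* (a ℚ.- c) ∎
    where
    open ≡-Reasoning
    open +-*-Solver
    *-distrib-- : ∀ p q r → p ℚ.* (q ℚ.- r) ≡ p ℚ.* q ℚ.- p ℚ.* r
    *-distrib-- p q r = trans (ℚ.*-distribˡ-+ p q (ℚ.- r))
                              (cong (p ℚ.* q ℚ.+_) (sym (ℚ.neg-distribʳ-* p r)))

  divide : ∀ {s δ} → 0ℚ ℚ.< s → 0ℚ ℚ.< δ → Σ[ η ∈ ℚ ] 0ℚ ℚ.< η × s ℚ.* η ≡ δ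
  divide {s} {δ} 0<s 0<δ = s⁻¹ ℚ.* δ
    , subst (ℚ._< s⁻¹ ℚ.* δ) (ℚ.*-zeroʳ s⁻¹) (ℚ.*-monoʳ-<-pos s⁻¹ {{ℚ.1/pos⇒pos s {{ℚ.positive 0<s}}}} 0<δ)
    , trans (sym (ℚ.*-assoc s s⁻¹ δ))
            (trans (cong (ℚ._* δ) (ℚ.*-inverseʳ s {{s≢0}})) (ℚ.*-identityˡ δ))
    where
    s≢0 : ℚ.NonZero s
    s≢0 = ℚ.pos⇒nonZero s {{ℚ.positive 0<s}}
    s⁻¹ : ℚ
    s⁻¹ = (ℚ.1/ s) {{s≢0}}

  product-bound : ∀ {A B η δ} → 0ℚ ℚ.< A → 0ℚ ℚ.< B → (A ℚ.+ B) ℚ.* η ≡ δ → ∀ a b c d →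
    ℚ.∣ a ∣ ℚ.≤ A → ℚ.∣ d ∣ ℚ.≤ B → ℚ.∣ a ℚ.- c ∣ ℚ.≤ η → ℚ.∣ b ℚ.- d ∣ ℚ.≤ η →
    ℚ.∣ a ℚ.* b ℚ.- c ℚ.* d ∣ ℚ.≤ δ
  product-bound {A} {B} {η} {δ} 0<A 0<B Sη≡δ a b c d a≤A d≤B ac bd = begin
      ℚ.∣ a ℚ.* b ℚ.- c ℚ.* d ∣
        ≡⟨ cong ℚ.∣_∣ (product-difference a b c d) ⟩
      ℚ.∣ a ℚ.* (b ℚ.- d) ℚ.+ d ℚ.* (a ℚ.- c) ∣
        ≤⟨ ℚ.∣p+q∣≤∣p∣+∣q∣ (a ℚ.* (b ℚ.- d)) (d ℚ.* (a ℚ.- c)) ⟩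
      ℚ.∣ a ℚ.* (b ℚ.- d) ∣ ℚ.+ ℚ.∣ d ℚ.* (a ℚ.- c) ∣
        ≤⟨ ℚ.+-mono-≤ (*-mono-∣∣ a (b ℚ.- d) 0<A a≤A bd) (*-mono-∣∣ d (a ℚ.- c) 0<B d≤B ac) ⟩
      A ℚ.* η ℚ.+ B ℚ.* η
        ≡⟨ sym (ℚ.*-distribʳ-+ η A B) ⟩
      (A ℚ.+ B) ℚ.* η
        ≡⟨ Sη≡δ ⟩
      δ ∎
    where open ℚ.≤-Reasoning

  Cauchy-* : ∀ x y → Cauchy x → Cauchy y → Cauchy (λ i → x i ℚ.* y i)
  Cauchy-* x y cx cy {δ} 0<δ =
    let A , 0<A , K , bx = bounded x cx
        B , 0<B , L , by = bounded y cy
        η , 0<η , Sη≡δ   = divide (ℚ.+-mono-< 0<A 0<B) 0<δ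
        M , f            = cx 0<η
        N , g            = cy 0<η
    in (K ℕ.⊔ L) ℕ.⊔ (M ℕ.⊔ N) , λ {i} {j} p q →
      let p₁ = ℕ.m⊔n≤o⇒m≤o (K ℕ.⊔ L) (M ℕ.⊔ N) p
          p₂ = ℕ.m⊔n≤o⇒n≤o (K ℕ.⊔ L) (M ℕ.⊔ N) p
          q₁ = ℕ.m⊔n≤o⇒m≤o (K ℕ.⊔ L) (M ℕ.⊔ N) q
          q₂ = ℕ.m⊔n≤o⇒n≤o (K ℕ.⊔ L) (M ℕ.⊔ N) q
      in product-bound 0<A 0<B Sη≡δ (x i) (y i) (x j) (y j)
           (bx (ℕ.m⊔n≤o⇒m≤o K L p₁)) (by (ℕ.m⊔n≤o⇒n≤o K L q₁))
           (f (ℕ.m⊔n≤o⇒m≤o M N p₂) (ℕ.m⊔n≤o⇒m≤o M N q₂))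
           (g (ℕ.m⊔n≤o⇒n≤o M N p₂) (ℕ.m⊔n≤o⇒n≤o M N q₂))

infixl 6 _-ᴿ_
infixl 7 _*ᴿ_ _/ᴿ_

_-ᴿ_ : ℝ → ℝ → ℝ
(x -ᴿ y) .approx i = approx x i ℚ.- approx y i
(x -ᴿ y) .cauchy   = Cauchy-- (approx x) (approx y) (cauchy x) (cauchy y)

_*ᴿ_ : ℝ → ℝ → ℝ
(x *ᴿ y) .approx i = approx x i ℚ.* approx y i
(x *ᴿ y) .cauchy   = Cauchy-* (approx x) (approx y) (cauchy x) (cauchy y)

_/ᴿ_ : ℝ → (m : ℕ) .{{_ : NonZero m}} → ℝ
x /ᴿ m = x *ᴿ fromℚ (1ℤ ℚ./ m)

-- Since 2 ^ a ≤ n ^ (k + 1) < 2 ^ (a + 1) for a = ⌊log₂ (n ^ (k + 1))⌋, the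
-- quotient a / (k + 1) approximates log₂ n from below to within 1 / (k + 1).

log₂-approx : ℕ → ℕ → ℚ
log₂-approx n k = + ⌊log₂ (n ℕ.^ suc k) ⌋ ℚ./ suc k

<2^⇒⌊log₂⌋≤ : ∀ b {n} → n ℕ.< 2 ℕ.^ suc b → ⌊log₂ n ⌋ ℕ.≤ b
<2^⇒⌊log₂⌋≤ zero    {0}           _ = z≤n
<2^⇒⌊log₂⌋≤ zero    {1}           _ = z≤n
<2^⇒⌊log₂⌋≤ zero    {suc (suc n)} (s≤s (s≤s ()))
<2^⇒⌊log₂⌋≤ (suc b) {n} n<2^ = begin
    ⌊log₂ n ⌋                ≤⟨ ℕ.m≤n+m∸n ⌊log₂ n ⌋ 1 ⟩
    1 ℕ.+ (⌊log₂ n ⌋ ℕ.∸ 1)  ≡⟨ cong suc (sym (⌊log₂⌊n/2⌋⌋≡⌊log₂n⌋∸1 n)) ⟩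
    1 ℕ.+ ⌊log₂ ⌊ n /2⌋ ⌋    ≤⟨ s≤s (<2^⇒⌊log₂⌋≤ b (ℕ.*-cancelˡ-< 2 ⌊ n /2⌋ (2 ℕ.^ suc b) (ℕ.≤-<-trans 2*⌊n/2⌋≤n n<2^))) ⟩
    1 ℕ.+ b                  ∎
  where
  open ℕ.≤-Reasoning
  2*⌊n/2⌋≤n : 2 ℕ.* ⌊ n /2⌋ ℕ.≤ n
  2*⌊n/2⌋≤n = subst₂ ℕ._≤_ (cong (⌊ n /2⌋ ℕ.+_) (sym (ℕ.+-identityʳ _))) (ℕ.⌊n/2⌋+⌈n/2⌉≡n n)
                (ℕ.+-monoʳ-≤ ⌊ n /2⌋ (ℕ.⌊n/2⌋≤⌈n/2⌉ n))

2^⌊log₂⌋≤ : ∀ n .{{_ : NonZero n}} → 2 ℕ.^ ⌊log₂ n ⌋ ℕ.≤ n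
2^⌊log₂⌋≤ n with ⌊log₂ n ⌋ in eq
... | zero  = ℕ.>-nonZero⁻¹ n
... | suc b with 2 ℕ.^ suc b ℕ.≤? n
...   | yes p = p
...   | no ¬p = ⊥-elim (ℕ.<-irrefl refl (subst (ℕ._≤ b) eq (<2^⇒⌊log₂⌋≤ b (ℕ.≰⇒> ¬p))))

<2^suc⌊log₂⌋ : ∀ n → n ℕ.< 2 ℕ.^ suc ⌊log₂ n ⌋
<2^suc⌊log₂⌋ n with 2 ℕ.^ suc ⌊log₂ n ⌋ ℕ.≤? n
... | no ¬p = ℕ.≰⇒> ¬p
... | yes p = ⊥-elim (ℕ.<-irrefl refl
                (subst (ℕ._≤ ⌊log₂ n ⌋) (⌊log₂[2^n]⌋≡n (suc ⌊log₂ n ⌋)) (⌊log₂⌋-mono-≤ p)))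

2^-cancel-≤ : ∀ {a b} → 2 ℕ.^ a ℕ.≤ 2 ℕ.^ b → a ℕ.≤ b
2^-cancel-≤ {a} {b} p = subst₂ ℕ._≤_ (⌊log₂[2^n]⌋≡n a) (⌊log₂[2^n]⌋≡n b) (⌊log₂⌋-mono-≤ p)

log₂-cross : ∀ n .{{_ : NonZero n}} j k →
  ⌊log₂ (n ℕ.^ suc j) ⌋ ℕ.* suc k ℕ.≤ suc ⌊log₂ (n ℕ.^ suc k) ⌋ ℕ.* suc j
log₂-cross n j k = 2^-cancel-≤ (begin
    2 ℕ.^ (a ℕ.* suc k)         ≡⟨ sym (ℕ.^-*-assoc 2 a (suc k)) ⟩
    (2 ℕ.^ a) ℕ.^ suc k         ≤⟨ ℕ.^-monoˡ-≤ (suc k) (2^⌊log₂⌋≤ (n ℕ.^ suc j) {{ℕ.m^n≢0 n (suc j)}}) ⟩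
    (n ℕ.^ suc j) ℕ.^ suc k     ≡⟨ ℕ.^-*-assoc n (suc j) (suc k) ⟩
    n ℕ.^ (suc j ℕ.* suc k)     ≡⟨ cong (n ℕ.^_) (ℕ.*-comm (suc j) (suc k)) ⟩
    n ℕ.^ (suc k ℕ.* suc j)     ≡⟨ sym (ℕ.^-*-assoc n (suc k) (suc j)) ⟩
    (n ℕ.^ suc k) ℕ.^ suc j     ≤⟨ ℕ.^-monoˡ-≤ (suc j) (ℕ.<⇒≤ (<2^suc⌊log₂⌋ (n ℕ.^ suc k))) ⟩
    (2 ℕ.^ suc b) ℕ.^ suc j     ≡⟨ ℕ.^-*-assoc 2 (suc b) (suc j) ⟩
    2 ℕ.^ (suc b ℕ.* suc j)     ∎)
  where
  open ℕ.≤-Reasoning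
  a = ⌊log₂ (n ℕ.^ suc j) ⌋
  b = ⌊log₂ (n ℕ.^ suc k) ⌋

/-mono : ∀ a b j k → a ℕ.* suc k ℕ.≤ b ℕ.* suc j → + a ℚ./ suc j ℚ.≤ + b ℚ./ suc k
/-mono a b j k p = ℚ.toℚᵘ-cancel-≤ (begin
    toℚᵘ (+ a ℚ./ suc j) ≃⟨ ℚ.toℚᵘ-fromℚᵘ (mkℚᵘ (+ a) j) ⟩
    mkℚᵘ (+ a) j         ≤⟨ *≤* (subst₂ ℤ._≤_ (ℤ.pos-* a (suc k)) (ℤ.pos-* b (suc j)) (ℤ.+≤+ p)) ⟩
    mkℚᵘ (+ b) k         ≃⟨ ℚᵘ.≃-sym (ℚ.toℚᵘ-fromℚᵘ (mkℚᵘ (+ b) k)) ⟩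
    toℚᵘ (+ b ℚ./ suc k) ∎)
  where open ℚᵘ.≤-Reasoning

suc-/ : ∀ b k → + suc b ℚ./ suc k ≡ + 1 ℚ./ suc k ℚ.+ + b ℚ./ suc k
suc-/ b k = ℚ.toℚᵘ-injective (begin
    toℚᵘ (+ suc b ℚ./ suc k)                      ≈⟨ ℚ.toℚᵘ-fromℚᵘ (mkℚᵘ (+ suc b) k) ⟩
    mkℚᵘ (+ suc b) k                              ≈⟨ *≡* lemma ⟩
    mkℚᵘ (+ 1) k ℚᵘ.+ mkℚᵘ (+ b) k                ≈⟨ ℚᵘ.≃-sym (ℚᵘ.+-cong (ℚ.toℚᵘ-fromℚᵘ (mkℚᵘ (+ 1) k)) (ℚ.toℚᵘ-fromℚᵘ (mkℚᵘ (+ b) k))) ⟩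
    toℚᵘ (+ 1 ℚ./ suc k) ℚᵘ.+ toℚᵘ (+ b ℚ./ suc k) ≈⟨ ℚᵘ.≃-sym (ℚ.toℚᵘ-homo-+ (+ 1 ℚ./ suc k) (+ b ℚ./ suc k)) ⟩
    toℚᵘ (+ 1 ℚ./ suc k ℚ.+ + b ℚ./ suc k)        ∎)
  where
  open import Relation.Binary.Reasoning.Setoid ℚᵘ.≃-setoid
  K = + suc k
  lemma : + suc b ℤ.* (K ℤ.* K) ≡ (1ℤ ℤ.* K ℤ.+ + b ℤ.* K) ℤ.* K
  lemma = trans (sym (ℤ.*-assoc (+ suc b) K K)) (cong (ℤ._* K) (ℤ.*-distribʳ-+ K 1ℤ (+ b)))

∣∣≤ : ∀ p {δ} → p ℚ.≤ δ → ℚ.- p ℚ.≤ δ → ℚ.∣ p ∣ ℚ.≤ δ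
∣∣≤ p {δ} a b with ℚ.∣p∣≡p∨∣p∣≡-p p
... | inj₁ e = subst (ℚ._≤ δ) (sym e) a
... | inj₂ e = subst (ℚ._≤ δ) (sym e) b

1/suc-small : ∀ {δ} → 0ℚ ℚ.< δ → ∃[ N ] (∀ {k} → N ℕ.≤ k → + 1 ℚ./ suc k ℚ.≤ δ)
1/suc-small {mkℚ (+ zero) d c}     (ℚ.*<* (ℤ.+<+ ()))
1/suc-small {mkℚ (ℤ.-[1+ _ ]) d c} (ℚ.*<* ())
1/suc-small {δ@(mkℚ (+ suc a) d c)} _ = d , λ {k} d≤k → subst (+ 1 ℚ./ suc k ℚ.≤_) (ℚ.fromℚᵘ-toℚᵘ δ)
  (/-mono 1 (suc a) k d (subst (ℕ._≤ suc a ℕ.* suc k) (sym (ℕ.*-identityˡ (suc d)))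
    (ℕ.≤-trans (s≤s d≤k) (ℕ.m≤m+n (suc k) (a ℕ.* suc k)))))

log₂-cauchy : ∀ n .{{_ : NonZero n}} → Cauchy (log₂-approx n)
log₂-cauchy n {δ} 0<δ with 1/suc-small 0<δ
... | N , small = N , λ {i} {j} p q →
    ∣∣≤ (x i ℚ.- x j) (one-sided i j q)
      (subst (ℚ._≤ δ) (solve 2 (λ a b → a :- b := :- (b :- a)) refl (x j) (x i)) (one-sided j i p))
  where
  open +-*-Solver
  open ℚ.≤-Reasoning
  x = log₂-approx n
  one-sided : ∀ i j → N ℕ.≤ j → x i ℚ.- x j ℚ.≤ δ
  one-sided i j q = begin
    x i ℚ.- x j                       ≤⟨ ℚ.+-monoˡ-≤ (ℚ.- x j) (/-mono ⌊log₂ (n ℕ.^ suc i) ⌋ (suc b) i j (log₂-cross n i j)) ⟩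
    + suc b ℚ./ suc j ℚ.- x j         ≡⟨ cong (ℚ._- x j) (suc-/ b j) ⟩
    + 1 ℚ./ suc j ℚ.+ x j ℚ.- x j     ≡⟨ solve 2 (λ u v → u :+ v :- v := u) refl (+ 1 ℚ./ suc j) (x j) ⟩
    + 1 ℚ./ suc j                     ≤⟨ small q ⟩
    δ                                 ∎
    where b = ⌊log₂ (n ℕ.^ suc j) ⌋

log₂ : (n : ℕ) .{{_ : NonZero n}} → ℝ
log₂ n = mkℝ (log₂-approx n) (log₂-cauchy n)

-- A finitely supported distribution, as a list of weighted outcomes.
Dist : Set → Set
Dist A = List (A × ℚ)

pure : {A : Set} → A → Dist A
pure a = (a , 1ℚ) ∷ []

_>>=_ : {A B : Set} → Dist A → (A → Dist B) → Dist B
D >>= f = concatMap (λ (a , u) → List.map (λ (b , v) → b , u ℚ.* v) (f a)) D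

bernoulli : ℚ → Dist Bool
bernoulli p = (true , p) ∷ (false , 1ℚ ℚ.- p) ∷ []

coins : (n : ℕ) → ℚ → Dist (Vec Bool n)
coins zero    p = pure []
coins (suc n) p = do
  b  ← bernoulli p
  bs ← coins n p
  pure (b ∷ bs)

Pr : {A : Set} → Dist A → (A → Bool) → ℚ
Pr D E = List.foldr ℚ._+_ 0ℚ (List.map proj₂ (filterᵇ (E ∘ proj₁) D))

-- P(a) need not come with a decision procedure, so this asks for a decidable
-- event inside P of probability at least r.  Classically every property of the
-- outcomes is such an event, and this says that P has probability at least r.
Pr[_,_]≥_ : {A : Set} → Dist A → Pred A 0ℓ → ℚ → Set
Pr[_,_]≥_ {A} D P r = Σ[ E ∈ (A → Bool) ] (∀ a → T (E a) → P a) × r ℚ.≤ Pr D E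

AAS : {A : ℕ → Set} → (∀ n → Dist (A n)) → (∀ n → Pred (A n) 0ℓ) → Set
AAS D P = ∀ {δ} → 0ℚ ℚ.< δ → ∃[ N ] (∀ {n} → N ℕ.≤ n → Pr[ D n , P n ]≥ (1ℚ ℚ.- δ))

record Graph (n : ℕ) : Set where
  field
    adj       : Fin n → Fin n → Bool
    symmetric : ∀ i j → adj i j ≡ adj j i
    loopless  : ∀ i → adj i i ≡ false

open Graph public

emptyGraph : Graph 0
emptyGraph .adj ()
emptyGraph .symmetric ()
emptyGraph .loopless ()

-- The new vertex is zero; the vector lists its adjacencies to the old vertices.
addVertex : ∀ {n} → Graph n → Vec Bool n → Graph (suc n)
addVertex G s .adj zero    zero    = false
addVertex G s .adj zero    (suc j) = lookup s j
addVertex G s .adj (suc i) zero    = lookup s i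
addVertex G s .adj (suc i) (suc j) = adj G i j
addVertex G s .symmetric zero    zero    = refl
addVertex G s .symmetric zero    (suc j) = refl
addVertex G s .symmetric (suc i) zero    = refl
addVertex G s .symmetric (suc i) (suc j) = symmetric G i j
addVertex G s .loopless zero    = refl
addVertex G s .loopless (suc i) = loopless G i

-- One independent p-coin for every pair of vertices.
G⟨_,_⟩ : (n : ℕ) → ℚ → Dist (Graph n)
G⟨ zero  , p ⟩ = pure emptyGraph
G⟨ suc n , p ⟩ = do
  G ← G⟨ n , p ⟩
  s ← coins n p
  pure (addVertex G s)

IsCommonNeighbour : ∀ {n} → Graph n → Subset n → Pred (Fin n) 0ℓ
IsCommonNeighbour G σ v = ∀ i → i ∈ σ → adj G i v ≡ true

isCommonNeighbour? : ∀ {n} (G : Graph n) σ → Decidable (IsCommonNeighbour G σ)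
isCommonNeighbour? G σ v = all? λ i → (i ∈? σ) →-dec (adj G i v Bool.≟ true)

commonNeighbours : ∀ {n} → Graph n → Subset n → Subset n
commonNeighbours G σ = tabulate (does ∘ isCommonNeighbour? G σ)

record Complex (n : ℕ) : Set₁ where
  field
    Simplex  : Subset n → Set
    nonempty : ∀ {σ} → Simplex σ → Nonempty σ
    closed   : ∀ {σ τ} → Nonempty τ → τ ⊆ σ → Simplex σ → Simplex τ

open Complex public

private
  tabulate-mono : ∀ {n} {f g : Fin n → Bool} → (∀ i → f i ≡ true → g i ≡ true) →
                  ∣ tabulate f ∣ ℕ.≤ ∣ tabulate g ∣
  tabulate-mono {zero} h = z≤n
  tabulate-mono {suc n} {f} {g} h with f zero in eqf | g zero in eqg
  ... | false | false = tabulate-mono (h ∘ suc)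
  ... | false | true  = ℕ.m≤n⇒m≤1+n (tabulate-mono (h ∘ suc))
  ... | true  | true  = s≤s (tabulate-mono (h ∘ suc))
  ... | true  | false with trans (sym eqg) (h zero eqf)
  ...   | ()

  commonNeighbours-anti : ∀ {n} (G : Graph n) {σ τ} → τ ⊆ σ →
    ∣ commonNeighbours G σ ∣ ℕ.≤ ∣ commonNeighbours G τ ∣
  commonNeighbours-anti G {σ} {τ} τ⊆σ = tabulate-mono λ v e →
    dec-true (isCommonNeighbour? G τ v)
      λ i i∈τ → does-true (isCommonNeighbour? G σ v) e i (τ⊆σ i∈τ)
    where
    does-true : {A : Set} (a? : Dec A) → does a? ≡ true → A
    does-true (yes a) _ = a

multineighborComplex : ∀ {n} → ℕ → Graph n → Complex n
multineighborComplex m G .Simplex σ        = Nonempty σ × m ℕ.≤ ∣ commonNeighbours G σ ∣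
multineighborComplex m G .nonempty         = proj₁
multineighborComplex m G .closed ne τ⊆σ (_ , le) =
  ne , ℕ.≤-trans le (commonNeighbours-anti G τ⊆σ)

-- The k-dimensional faces, with the empty set as the only face of dimension -1
-- (present even in the complex without vertices).
Face : ∀ {n} → Complex n → ℤ → Subset n → Set
Face K k σ = (∣ σ ∣ ≡ 0 ⊎ Simplex K σ) × (+ ∣ σ ∣ ≡ k ℤ.+ 1ℤ)

-- (-1) to the number of elements of τ below v.
sign : ∀ {n} → Subset n → Fin n → ℤ
sign (_       ∷ τ) zero    = 1ℤ
sign (inside  ∷ τ) (suc v) = ℤ.- sign τ v
sign (outside ∷ τ) (suc v) = sign τ v

-- Integer chains are given by their coefficients, each face being oriented by
-- the order of Fin n.  From ∂[v₀ … v_q] = Σᵢ (-1)ⁱ [v₀ … v̂ᵢ … v_q], the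
-- coefficient of ∂c at τ collects those of c at τ ∪ {v}, v ∉ τ.
∂ : ∀ {n} → (Subset n → ℤ) → (Subset n → ℤ)
∂ {n} c τ = ∑[ v < n ]
  (if lookup τ v then 0ℤ else sign τ v ℤ.* c (τ [ v ]≔ inside))

record Chain {n} (K : Complex n) (k : ℤ) : Set where
  field
    coeff     : Subset n → ℤ
    supported : ∀ σ → ¬ Face K k σ → coeff σ ≡ 0ℤ

open Chain public

record Cycle {n} (K : Complex n) (k : ℤ) : Set where
  field
    chain : Chain K k
    ∂≡0   : ∀ τ → ∂ (coeff chain) τ ≡ 0ℤ

open Cycle public

∂-+ : ∀ {n} (c d : Subset n → ℤ) τ → ∂ (λ σ → c σ ℤ.+ d σ) τ ≡ ∂ c τ ℤ.+ ∂ d τ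
∂-+ {n} c d τ = trans (sum-cong-≗ termwise) (∑-distrib-+ {n} (term c) (term d))
  where
  term : (Subset n → ℤ) → Fin n → ℤ
  term c v = if lookup τ v then 0ℤ else sign τ v ℤ.* c (τ [ v ]≔ inside)
  termwise : ∀ v → term (λ σ → c σ ℤ.+ d σ) v ≡ term c v ℤ.+ term d v
  termwise v with lookup τ v
  ... | true  = refl
  ... | false = ℤ.*-distribˡ-+ (sign τ v) _ _

∂-0 : ∀ {n} (τ : Subset n) → ∂ (λ _ → 0ℤ) τ ≡ 0ℤ
∂-0 {n} τ = trans (sum-cong-≗ termwise) (sum-replicate-zero n)
  where
  termwise : ∀ v → (if lookup τ v then 0ℤ else sign τ v ℤ.* 0ℤ) ≡ 0ℤ
  termwise v with lookup τ v
  ... | true  = refl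
  ... | false = ℤ.*-zeroʳ (sign τ v)

∂-neg : ∀ {n} (c : Subset n → ℤ) τ → ∂ (λ σ → ℤ.- c σ) τ ≡ ℤ.- ∂ c τ
∂-neg c τ = inverseʳ-unique (∂ c τ) (∂ (λ σ → ℤ.- c σ) τ)
  (trans (sym (∂-+ c (λ σ → ℤ.- c σ) τ)) (trans (sum-cong-≗ termwise) (∂-0 τ)))
  where
  open import Algebra.Properties.AbelianGroup ℤ.+-0-abelianGroup using (inverseʳ-unique)
  termwise : ∀ v →
    (if lookup τ v then 0ℤ else sign τ v ℤ.* (c (τ [ v ]≔ inside) ℤ.+ ℤ.- c (τ [ v ]≔ inside))) ≡
    (if lookup τ v then 0ℤ else sign τ v ℤ.* 0ℤ)
  termwise v = cong (λ z → if lookup τ v then 0ℤ else sign τ v ℤ.* z) (ℤ.+-inverseʳ (c (τ [ v ]≔ inside)))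

module _ {n : ℕ} (K : Complex n) (k : ℤ) where

  private
    ⟦_⟧ : Cycle K k → Subset n → ℤ
    ⟦ z ⟧ = coeff (chain z)

    _∼_ : Cycle K k → Cycle K k → Set
    x ∼ y = Σ[ w ∈ Chain K (k ℤ.+ 1ℤ) ] (∀ σ → ∂ (coeff w) σ ≡ ⟦ x ⟧ σ ℤ.- ⟦ y ⟧ σ)

    0ᶜ : ∀ {j} → Chain K j
    0ᶜ .coeff _       = 0ℤ
    0ᶜ .supported _ _ = refl

    _+ᶜ_ : ∀ {j} → Chain K j → Chain K j → Chain K j
    (c +ᶜ d) .coeff σ       = coeff c σ ℤ.+ coeff d σ
    (c +ᶜ d) .supported σ f = cong₂ ℤ._+_ (supported c σ f) (supported d σ f)

    -ᶜ_ : ∀ {j} → Chain K j → Chain K j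
    (-ᶜ c) .coeff σ       = ℤ.- coeff c σ
    (-ᶜ c) .supported σ f = cong ℤ.-_ (supported c σ f)

    0ᶻ : Cycle K k
    0ᶻ .chain = 0ᶜ
    0ᶻ .∂≡0   = ∂-0

    _+ᶻ_ : Cycle K k → Cycle K k → Cycle K k
    (x +ᶻ y) .chain = chain x +ᶜ chain y
    (x +ᶻ y) .∂≡0 τ = trans (∂-+ ⟦ x ⟧ ⟦ y ⟧ τ) (cong₂ ℤ._+_ (∂≡0 x τ) (∂≡0 y τ))

    -ᶻ_ : Cycle K k → Cycle K k
    (-ᶻ x) .chain = -ᶜ chain x
    (-ᶻ x) .∂≡0 τ = trans (∂-neg ⟦ x ⟧ τ) (cong ℤ.-_ (∂≡0 x τ))

    ≗⇒∼ : ∀ x y → (∀ σ → ⟦ x ⟧ σ ≡ ⟦ y ⟧ σ) → x ∼ y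
    ≗⇒∼ x y e = 0ᶜ , λ σ → trans (∂-0 σ) (sym (ℤ.i≡j⇒i-j≡0 (e σ)))

    ∼-sym : ∀ {x y} → x ∼ y → y ∼ x
    ∼-sym {x} {y} (w , h) = -ᶜ w , λ σ →
      trans (∂-neg (coeff w) σ) (trans (cong ℤ.-_ (h σ))
        (ℤS.solve 2 (λ a b → ℤS.:- (a ℤS.:- b) ℤS.:= b ℤS.:- a) refl (⟦ x ⟧ σ) (⟦ y ⟧ σ)))

    ∼-trans : ∀ {x y z} → x ∼ y → y ∼ z → x ∼ z
    ∼-trans {x} {y} {z} (w , h) (w′ , h′) = w +ᶜ w′ , λ σ →
      trans (∂-+ (coeff w) (coeff w′) σ) (trans (cong₂ ℤ._+_ (h σ) (h′ σ))
        (ℤS.solve 3 (λ a b c → (a ℤS.:- b) ℤS.:+ (b ℤS.:- c) ℤS.:= a ℤS.:- c) refl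
          (⟦ x ⟧ σ) (⟦ y ⟧ σ) (⟦ z ⟧ σ)))

    +-cong : ∀ {x y u v} → x ∼ y → u ∼ v → (x +ᶻ u) ∼ (y +ᶻ v)
    +-cong {x} {y} {u} {v} (w , h) (w′ , h′) = w +ᶜ w′ , λ σ →
      trans (∂-+ (coeff w) (coeff w′) σ) (trans (cong₂ ℤ._+_ (h σ) (h′ σ))
        (ℤS.solve 4 (λ a b c d → (a ℤS.:- b) ℤS.:+ (c ℤS.:- d) ℤS.:= (a ℤS.:+ c) ℤS.:- (b ℤS.:+ d)) refl
          (⟦ x ⟧ σ) (⟦ y ⟧ σ) (⟦ u ⟧ σ) (⟦ v ⟧ σ)))

    neg-cong : ∀ {x y} → x ∼ y → (-ᶻ x) ∼ (-ᶻ y)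
    neg-cong {x} {y} (w , h) = -ᶜ w , λ σ →
      trans (∂-neg (coeff w) σ) (trans (cong ℤ.-_ (h σ))
        (ℤS.solve 2 (λ a b → ℤS.:- (a ℤS.:- b) ℤS.:= (ℤS.:- a) ℤS.:- (ℤS.:- b)) refl (⟦ x ⟧ σ) (⟦ y ⟧ σ)))

  H̃ : AbelianGroup 0ℓ 0ℓ
  H̃ = record
    { Carrier = Cycle K k
    ; _≈_ = _∼_
    ; _∙_ = _+ᶻ_
    ; ε   = 0ᶻ
    ; _⁻¹ = -ᶻ_
    ; isAbelianGroup = record
      { isGroup = record
        { isMonoid = record
          { isSemigroup = record
            { isMagma = record
              { isEquivalence = record
                { refl  = λ {x} → ≗⇒∼ x x (λ _ → refl)
                ; sym   = λ {x} {y} → ∼-sym {x} {y}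
                ; trans = λ {x} {y} {z} → ∼-trans {x} {y} {z}
                }
              ; ∙-cong = λ {x} {y} {u} {v} → +-cong {x} {y} {u} {v}
              }
            ; assoc = λ x y z → ≗⇒∼ ((x +ᶻ y) +ᶻ z) (x +ᶻ (y +ᶻ z)) λ σ → ℤ.+-assoc (⟦ x ⟧ σ) (⟦ y ⟧ σ) (⟦ z ⟧ σ)
            }
          ; identity = (λ x → ≗⇒∼ (0ᶻ +ᶻ x) x λ σ → ℤ.+-identityˡ (⟦ x ⟧ σ))
                     , (λ x → ≗⇒∼ (x +ᶻ 0ᶻ) x λ σ → ℤ.+-identityʳ (⟦ x ⟧ σ))
          }
        ; inverse = (λ x → ≗⇒∼ ((-ᶻ x) +ᶻ x) 0ᶻ λ σ → ℤ.+-inverseˡ (⟦ x ⟧ σ))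
                  , (λ x → ≗⇒∼ (x +ᶻ (-ᶻ x)) 0ᶻ λ σ → ℤ.+-inverseʳ (⟦ x ⟧ σ))
        ; ⁻¹-cong = λ {x} {y} → neg-cong {x} {y}
        }
      ; comm = λ x y → ≗⇒∼ (x +ᶻ y) (y +ᶻ x) λ σ → ℤ.+-comm (⟦ x ⟧ σ) (⟦ y ⟧ σ)
      }
    }

IsTrivial : AbelianGroup 0ℓ 0ℓ → Set
IsTrivial A = ∀ x → x ≈ ε
  where open AbelianGroup A

{-# OPTIONS --safe #-}

-- If every set of l vertices has m common neighbours, then N_m(G) contains every
-- simplex with l vertices, so coning with vertex 0 fills each (l − 2)-cycle.  The
-- number X_σ of common neighbours of a set σ satisfies
--   E[(1 − 2^-k)^X_σ] = (1 − 2^-(k + ∣σ∣))^(n − ∣σ∣),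
-- by induction on the graph: a new vertex outside σ multiplies the expectation by
-- one more factor, and a new vertex in σ halves each old common neighbour's chance
-- to survive.  For k = 1, Markov's inequality bounds the probability that some
-- l-set has fewer than m common neighbours by n^l 2^m (1 − 2^-(l + 1))^(n − l).
-- The hypothesis on l amounts to (2^l)^(r + 1) ≤ 2 n^r for a fixed r, and under it
-- this bound tends to 0.

module Submission where

open import Defs
open import Algebra.Bundles using (CommutativeRing)
open import Data.Bool.Base using (Bool; true; false; if_then_else_; _∧_)
import Data.Bool.Properties as Bool
open import Data.Empty using (⊥-elim)
open import Data.Fin.Base using (zero; suc)
open import Data.Fin.Subset using (Subset; inside; outside; ∣_∣; Nonempty; ⊥; ∁; _∩_)
open import Data.Fin.Subset.Properties using (_⊆?_; nonempty?; Empty-unique; ∣⊥∣≡0; ∣∁p∣≡n∸∣p∣)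
open import Data.Integer.Base as ℤ using (ℤ; +_; _-_; 0ℤ; 1ℤ)
import Data.Integer.Properties as ℤ
open import Data.Integer.Solver using () renaming (module +-*-Solver to ℤ-Solver)
open import Data.List.Base as List using (List; []; _∷_; _++_; length)
open import Data.List.Membership.Propositional using (_∈_)
open import Data.List.Membership.Propositional.Properties using (∈-map⁺; ∈-++⁺ˡ; ∈-++⁺ʳ)
open import Data.List.Properties using (length-++; length-map)
open import Data.List.Relation.Unary.All as All using (All; []; _∷_)
import Data.List.Relation.Unary.All.Properties as All
open import Data.List.Relation.Unary.Any using (here; there)
open import Data.Nat.Base as ℕ using (ℕ; zero; suc; NonZero; z≤n; s≤s)
import Data.Nat.DivMod as ℕ
open import Data.Nat.Logarithm using (⌊log₂_⌋; ⌊log₂⌋-mono-≤; ⌊log₂[2^n]⌋≡n)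
import Data.Nat.Properties as ℕ
open import Data.Nat.Solver using () renaming (module +-*-Solver to ℕ-Solver)
open import Data.Product.Base as Product using (_,_; ∃-syntax)
open import Data.Rational.Base as ℚ using (ℚ; 0ℚ; 1ℚ; ½)
import Data.Rational.Properties as ℚ
open import Data.Rational.Solver using () renaming (module +-*-Solver to ℚ-Solver)
open import Data.Rational.Unnormalised.Base as ℚᵘ using (mkℚᵘ; *≡*)
import Data.Rational.Unnormalised.Properties as ℚᵘ
open import Data.Sum.Base using (_⊎_; inj₁; inj₂)
open import Data.Vec.Base as Vec using (Vec; []; _∷_; lookup; here; there; _[_]≔_)
import Data.Vec.Properties as Vec
open import Function.Base using (_∘_; case_of_)
open import Function.Bundles using (mk⇔)
open import Relation.Binary.PropositionalEquality
  using (_≡_; _≢_; refl; sym; trans; cong; cong₂; subst; subst₂; module ≡-Reasoning)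
open import Relation.Nullary using (Dec; does; yes; no)
open import Relation.Nullary.Decidable using (⌊_⌋; toWitness; does-⇔; dec-false; _×-dec_)
open import Algebra.Properties.CommutativeMonoid.Sum ℤ.+-0-commutativeMonoid using (sum-cong-≗)
open import Algebra.Properties.Semiring.Exp (CommutativeRing.semiring ℚ.+-*-commutativeRing)
  using (_^_; ^-assocʳ)
open import Algebra.Properties.Semiring.Mult (CommutativeRing.semiring ℚ.+-*-commutativeRing)
  using (_×_; ×-assocˡ; ×-comm-*; ×-assoc-*)

-- Coning

-- Vertex 0 precedes every other vertex: adding it costs no sign, and its presence in a set flips
-- the sign of every other insertion. So `∂` splits along the first coordinate, here and in
-- `∂-inside`.
∂-outside : ∀ {n} (c : Subset (suc n) → ℤ) τ →
  ∂ c (outside ∷ τ) ≡ c (inside ∷ τ) ℤ.+ ∂ (c ∘ (outside ∷_)) τ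
∂-outside c τ = cong (ℤ._+ ∂ (c ∘ (outside ∷_)) τ) (ℤ.*-identityˡ (c (inside ∷ τ)))

∂-inside : ∀ {n} (c : Subset (suc n) → ℤ) τ →
  ∂ c (inside ∷ τ) ≡ ℤ.- ∂ (c ∘ (inside ∷_)) τ
∂-inside c τ = trans (ℤ.+-identityˡ _) (trans (sum-cong-≗ termwise) (∂-neg (c ∘ (inside ∷_)) τ))
  where
  termwise : ∀ v →
    (if lookup τ v then 0ℤ else (ℤ.- sign τ v) ℤ.* c (inside ∷ τ [ v ]≔ inside)) ≡
    (if lookup τ v then 0ℤ else sign τ v ℤ.* (ℤ.- c (inside ∷ τ [ v ]≔ inside)))
  termwise v with lookup τ v
  ... | true  = refl
  ... | false = trans (sym (ℤ.neg-distribˡ-* (sign τ v) _)) (ℤ.neg-distribʳ-* (sign τ v) _)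

-- The join of vertex 0 with the part of the chain that avoids it; no sign appears because 0 is the
-- lowest vertex.
cone : ∀ {n} → (Subset (suc n) → ℤ) → (Subset (suc n) → ℤ)
cone c (inside  ∷ σ) = c (outside ∷ σ)
cone c (outside ∷ σ) = 0ℤ

-- `cone` is a contracting homotopy: ∂ ∘ cone + cone ∘ ∂ = id. At a set containing 0 the cone
-- contributes `- b`, and the vanishing of `∂ c` at the same set without 0 says `a + b = 0`, which
-- turns `- b` into `a`.
∂-cone : ∀ {n} (c : Subset (suc n) → ℤ) → (∀ τ → ∂ c τ ≡ 0ℤ) → ∀ τ → ∂ (cone c) τ ≡ c τ
∂-cone c ∂c≡0 (outside ∷ τ) = begin
  ∂ (cone c) (outside ∷ τ)          ≡⟨ ∂-outside (cone c) τ ⟩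
  c (outside ∷ τ) ℤ.+ ∂ (λ _ → 0ℤ) τ ≡⟨ cong (λ z → c (outside ∷ τ) ℤ.+ z) (∂-0 τ) ⟩
  c (outside ∷ τ) ℤ.+ 0ℤ            ≡⟨ ℤ.+-identityʳ _ ⟩
  c (outside ∷ τ)                   ∎
  where open ≡-Reasoning
∂-cone c ∂c≡0 (inside ∷ τ) = begin
  ∂ (cone c) (inside ∷ τ)           ≡⟨ ∂-inside (cone c) τ ⟩
  ℤ.- b                             ≡⟨ ℤ-Solver.solve 2 (λ a b → :- b := a :- (a :+ b)) refl a b ⟩
  a ℤ.- (a ℤ.+ b)                   ≡⟨ cong (λ z → a ℤ.- z) (trans (sym (∂-outside c τ)) (∂c≡0 (outside ∷ τ))) ⟩
  a ℤ.- 0ℤ                          ≡⟨ ℤ.+-identityʳ a ⟩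
  a                                 ∎
  where
  open ≡-Reasoning
  open ℤ-Solver using (:-_; _:=_; _:-_; _:+_)
  a = c (inside ∷ τ)
  b = ∂ (c ∘ (outside ∷_)) τ

full-skeleton⇒H̃-trivial : ∀ {n} (K : Complex (suc n)) k →
  (∀ σ → + ∣ σ ∣ ≡ k ℤ.+ + 2 → ∣ σ ∣ ≡ 0 ⊎ Simplex K σ) → IsTrivial (H̃ K k)
full-skeleton⇒H̃-trivial K k full z = w , λ σ → trans (∂-cone c (∂≡0 z) σ) (sym (ℤ.+-identityʳ (c σ)))
  where
  c = coeff (chain z)
  shift : ∀ a → (k ℤ.+ a) ℤ.+ 1ℤ ≡ k ℤ.+ (a ℤ.+ 1ℤ)
  shift a = ℤ.+-assoc k a 1ℤ
  w : Chain K (k ℤ.+ 1ℤ)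
  w .coeff = cone c
  w .supported (outside ∷ σ) ¬face = refl
  w .supported (inside  ∷ σ) ¬face = supported (chain z) (outside ∷ σ) λ (_ , |σ|≡k+1) →
    let |v*σ|≡ = trans (cong (ℤ.suc) |σ|≡k+1) (ℤ-Solver.solve 1 (λ k → con 1ℤ :+ (k :+ con 1ℤ) := (k :+ con 1ℤ) :+ con 1ℤ) refl k)
    in ¬face (full (inside ∷ σ) (trans |v*σ|≡ (shift 1ℤ)) , |v*σ|≡)
    where open ℤ-Solver using (con; _:+_; _:=_)

∣p∣≢0⇒Nonempty : ∀ {n} (p : Subset n) → ∣ p ∣ ≢ 0 → Nonempty p
∣p∣≢0⇒Nonempty {n} p ∣p∣≢0 with nonempty? p
... | yes ne = ne
... | no  ¬ne = ⊥-elim (∣p∣≢0 (trans (cong ∣_∣ (Empty-unique ¬ne)) (∣⊥∣≡0 n)))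

H̃-trivial : ∀ {n} m (G : Graph (suc n)) l →
  (∀ σ → + ∣ σ ∣ ≡ l → m ℕ.≤ ∣ commonNeighbours G σ ∣) →
  IsTrivial (H̃ (multineighborComplex m G) (l ℤ.- + 2))
H̃-trivial m G l m≤ = full-skeleton⇒H̃-trivial (multineighborComplex m G) (l ℤ.- + 2) full
  where
  open ℤ-Solver using (con; _:+_; _:-_; _:=_)
  full : ∀ σ → + ∣ σ ∣ ≡ (l ℤ.- + 2) ℤ.+ + 2 → ∣ σ ∣ ≡ 0 ⊎ (Nonempty σ Product.× m ℕ.≤ ∣ commonNeighbours G σ ∣)
  full σ ∣σ∣≡ with ∣ σ ∣ ℕ.≟ 0
  ... | yes 0≡ = inj₁ 0≡
  ... | no  ≢0 = inj₂ (∣p∣≢0⇒Nonempty σ ≢0 , m≤ σ (trans ∣σ∣≡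
                   (ℤ-Solver.solve 1 (λ l → (l :- con (+ 2)) :+ con (+ 2) := l) refl l)))

-- Common neighbours after adding a vertex

does-≟true : ∀ b → does (b Bool.≟ true) ≡ b
does-≟true true  = refl
does-≟true false = refl

commonNeighbours-outside : ∀ {n} (G : Graph n) s σ →
  commonNeighbours (addVertex G s) (outside ∷ σ) ≡ does (σ ⊆? s) ∷ commonNeighbours G σ
commonNeighbours-outside G s σ = cong₂ _∷_
  (does-⇔ (mk⇔ (λ h {i} i∈σ → Vec.lookup⇒[]= i s (h (suc i) (there i∈σ)))
               (λ { σ⊆s (suc i) (there i∈σ) → Vec.[]=⇒lookup (σ⊆s i∈σ) }))
          (isCommonNeighbour? (addVertex G s) (outside ∷ σ) zero) (σ ⊆? s))
  (Vec.tabulate-cong λ v →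
    does-⇔ (mk⇔ (λ h i i∈σ → h (suc i) (there i∈σ))
                (λ { h (suc i) (there i∈σ) → h i i∈σ }))
           (isCommonNeighbour? (addVertex G s) (outside ∷ σ) (suc v)) (isCommonNeighbour? G σ v))

commonNeighbours-inside : ∀ {n} (G : Graph n) s σ →
  commonNeighbours (addVertex G s) (inside ∷ σ) ≡ outside ∷ (s ∩ commonNeighbours G σ)
commonNeighbours-inside G s σ = cong₂ _∷_
  -- Vertex 0 now lies in the set and is not adjacent to itself.
  (dec-false (isCommonNeighbour? (addVertex G s) (inside ∷ σ) zero) λ h → case h zero here of λ ())
  (trans (Vec.tabulate-cong componentwise) (Vec.tabulate∘lookup (s ∩ commonNeighbours G σ)))
  where
  open ≡-Reasoning
  componentwise : ∀ v → does (isCommonNeighbour? (addVertex G s) (inside ∷ σ) (suc v)) ≡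
                        lookup (s ∩ commonNeighbours G σ) v
  componentwise v = begin
    does (isCommonNeighbour? (addVertex G s) (inside ∷ σ) (suc v))
      ≡⟨ does-⇔ (mk⇔ (λ h → h zero here , λ i i∈σ → h (suc i) (there i∈σ))
                     (λ { (e , h) zero here → e ; (e , h) (suc i) (there i∈σ) → h i i∈σ }))
                (isCommonNeighbour? (addVertex G s) (inside ∷ σ) (suc v))
                ((lookup s v Bool.≟ true) ×-dec isCommonNeighbour? G σ v) ⟩
    does (lookup s v Bool.≟ true) ∧ does (isCommonNeighbour? G σ v)
      ≡⟨ cong₂ _∧_ (does-≟true (lookup s v)) (sym (Vec.lookup∘tabulate (does ∘ isCommonNeighbour? G σ) v)) ⟩
    lookup s v ∧ lookup (commonNeighbours G σ) v
      ≡⟨ sym (Vec.lookup-zipWith _∧_ v s (commonNeighbours G σ)) ⟩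
    lookup (s ∩ commonNeighbours G σ) v ∎

-- Expectations

𝔼 : ∀ {A : Set} → Dist A → (A → ℚ) → ℚ
𝔼 []            f = 0ℚ
𝔼 ((a , u) ∷ D) f = u ℚ.* f a ℚ.+ 𝔼 D f

𝔼-cong : ∀ {A} (D : Dist A) {f g} → (∀ a → f a ≡ g a) → 𝔼 D f ≡ 𝔼 D g
𝔼-cong []            f≗g = refl
𝔼-cong ((a , u) ∷ D) f≗g = cong₂ ℚ._+_ (cong (u ℚ.*_) (f≗g a)) (𝔼-cong D f≗g)

𝔼-++ : ∀ {A} (D D′ : Dist A) f → 𝔼 (D ++ D′) f ≡ 𝔼 D f ℚ.+ 𝔼 D′ f
𝔼-++ []            D′ f = sym (ℚ.+-identityˡ _)
𝔼-++ ((a , u) ∷ D) D′ f =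
  trans (cong (u ℚ.* f a ℚ.+_) (𝔼-++ D D′ f)) (sym (ℚ.+-assoc (u ℚ.* f a) (𝔼 D f) (𝔼 D′ f)))

𝔼-scale : ∀ {A} u (D : Dist A) f → 𝔼 (List.map (λ (a , v) → a , u ℚ.* v) D) f ≡ u ℚ.* 𝔼 D f
𝔼-scale u []            f = sym (ℚ.*-zeroʳ u)
𝔼-scale u ((a , v) ∷ D) f =
  trans (cong₂ ℚ._+_ (ℚ.*-assoc u v (f a)) (𝔼-scale u D f)) (sym (ℚ.*-distribˡ-+ u (v ℚ.* f a) (𝔼 D f)))

𝔼->>= : ∀ {A B} (D : Dist A) (k : A → Dist B) f → 𝔼 (D >>= k) f ≡ 𝔼 D (λ a → 𝔼 (k a) f)
𝔼->>= []            k f = refl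
𝔼->>= ((a , u) ∷ D) k f =
  trans (𝔼-++ (List.map (λ (b , v) → b , u ℚ.* v) (k a)) (D >>= k) f)
        (cong₂ ℚ._+_ (𝔼-scale u (k a) f) (𝔼->>= D k f))

𝔼-pure : ∀ {A : Set} (a : A) f → 𝔼 (pure a) f ≡ f a
𝔼-pure a f = trans (ℚ.+-identityʳ _) (ℚ.*-identityˡ (f a))

𝔼-+ : ∀ {A} (D : Dist A) f g → 𝔼 D (λ a → f a ℚ.+ g a) ≡ 𝔼 D f ℚ.+ 𝔼 D g
𝔼-+ []            f g = refl
𝔼-+ ((a , u) ∷ D) f g = trans (cong (u ℚ.* (f a ℚ.+ g a) ℚ.+_) (𝔼-+ D f g))
  (solve 5 (λ u x y a b → u :* (x :+ y) :+ (a :+ b) := (u :* x :+ a) :+ (u :* y :+ b)) refl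
    u (f a) (g a) (𝔼 D f) (𝔼 D g))
  where open ℚ-Solver

𝔼-*ˡ : ∀ {A} (D : Dist A) c f → 𝔼 D (λ a → c ℚ.* f a) ≡ c ℚ.* 𝔼 D f
𝔼-*ˡ []            c f = sym (ℚ.*-zeroʳ c)
𝔼-*ˡ ((a , u) ∷ D) c f = trans (cong (u ℚ.* (c ℚ.* f a) ℚ.+_) (𝔼-*ˡ D c f))
  (solve 4 (λ u c x y → u :* (c :* x) :+ c :* y := c :* (u :* x :+ y)) refl u c (f a) (𝔼 D f))
  where open ℚ-Solver

𝔼-*ʳ : ∀ {A} (D : Dist A) c f → 𝔼 D (λ a → f a ℚ.* c) ≡ 𝔼 D f ℚ.* c
𝔼-*ʳ D c f = trans (𝔼-cong D λ a → ℚ.*-comm (f a) c) (trans (𝔼-*ˡ D c f) (ℚ.*-comm c (𝔼 D f)))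

-- A `Dist` may carry arbitrary rational weights, so positivity and total mass are tracked
-- separately. Stating both through `𝔼` instead of the list of weights lets closure under `_>>=_`
-- follow from `𝔼->>=`.
record IsProbability {A : Set} (D : Dist A) : Set where
  field
    𝔼-nonNeg : ∀ {f} → (∀ a → 0ℚ ℚ.≤ f a) → 0ℚ ℚ.≤ 𝔼 D f
    𝔼-const  : ∀ c → 𝔼 D (λ _ → c) ≡ c

  𝔼-mono : ∀ {f g} → (∀ a → f a ℚ.≤ g a) → 𝔼 D f ℚ.≤ 𝔼 D g
  𝔼-mono {f} {g} f≤g = begin
    𝔼 D f                                ≡⟨ sym (ℚ.+-identityʳ _) ⟩
    𝔼 D f ℚ.+ 0ℚ                         ≤⟨ ℚ.+-monoʳ-≤ (𝔼 D f) (𝔼-nonNeg λ a →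
                                              subst (ℚ._≤ g a ℚ.- f a) (ℚ.+-inverseʳ (f a)) (ℚ.+-monoˡ-≤ (ℚ.- f a) (f≤g a))) ⟩
    𝔼 D f ℚ.+ 𝔼 D (λ a → g a ℚ.- f a)    ≡⟨ sym (𝔼-+ D f (λ a → g a ℚ.- f a)) ⟩
    𝔼 D (λ a → f a ℚ.+ (g a ℚ.- f a))    ≡⟨ 𝔼-cong D (λ a → solve 2 (λ x y → x :+ (y :- x) := y) refl (f a) (g a)) ⟩
    𝔼 D g                                ∎
    where open ℚ.≤-Reasoning
          open ℚ-Solver

  𝔼-complement : ∀ f → 𝔼 D (λ a → 1ℚ ℚ.- f a) ≡ 1ℚ ℚ.- 𝔼 D f
  𝔼-complement f = begin
    𝔼 D (λ a → 1ℚ ℚ.- f a)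
      ≡⟨ 𝔼-cong D (λ a → cong (1ℚ ℚ.+_) (neg≡-1* (f a))) ⟩
    𝔼 D (λ a → 1ℚ ℚ.+ (ℚ.- 1ℚ) ℚ.* f a)
      ≡⟨ 𝔼-+ D (λ _ → 1ℚ) (λ a → (ℚ.- 1ℚ) ℚ.* f a) ⟩
    𝔼 D (λ _ → 1ℚ) ℚ.+ 𝔼 D (λ a → (ℚ.- 1ℚ) ℚ.* f a)
      ≡⟨ cong₂ ℚ._+_ (𝔼-const 1ℚ) (𝔼-*ˡ D (ℚ.- 1ℚ) f) ⟩
    1ℚ ℚ.+ (ℚ.- 1ℚ) ℚ.* 𝔼 D f
      ≡⟨ cong (1ℚ ℚ.+_) (sym (neg≡-1* (𝔼 D f))) ⟩
    1ℚ ℚ.- 𝔼 D f ∎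
    where
    open ≡-Reasoning
    neg≡-1* : ∀ p → ℚ.- p ≡ (ℚ.- 1ℚ) ℚ.* p
    neg≡-1* p = trans (cong ℚ.-_ (sym (ℚ.*-identityˡ p))) (ℚ.neg-distribˡ-* 1ℚ p)

open IsProbability

pure-isProbability : ∀ {A : Set} (a : A) → IsProbability (pure a)
pure-isProbability a .𝔼-nonNeg {f} 0≤f = subst (0ℚ ℚ.≤_) (sym (𝔼-pure a f)) (0≤f a)
pure-isProbability a .𝔼-const c        = 𝔼-pure a (λ _ → c)

>>=-isProbability : ∀ {A B} {D : Dist A} {k : A → Dist B} →
  IsProbability D → (∀ a → IsProbability (k a)) → IsProbability (D >>= k)
>>=-isProbability {D = D} {k} pD pk .𝔼-nonNeg {f} 0≤f =
  subst (0ℚ ℚ.≤_) (sym (𝔼->>= D k f)) (𝔼-nonNeg pD λ a → 𝔼-nonNeg (pk a) 0≤f)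
>>=-isProbability {D = D} {k} pD pk .𝔼-const c =
  trans (𝔼->>= D k _) (trans (𝔼-cong D λ a → 𝔼-const (pk a) c) (𝔼-const pD c))

𝔼-fairCoin : ∀ f → 𝔼 (bernoulli ½) f ≡ ½ ℚ.* f true ℚ.+ ½ ℚ.* f false
𝔼-fairCoin f = cong (½ ℚ.* f true ℚ.+_) (ℚ.+-identityʳ _)

½p+½p≡p : ∀ c → ½ ℚ.* c ℚ.+ ½ ℚ.* c ≡ c
½p+½p≡p c = trans (sym (ℚ.*-distribʳ-+ c ½ ½)) (ℚ.*-identityˡ c)

0≤p*q : ∀ {p q} → 0ℚ ℚ.≤ p → 0ℚ ℚ.≤ q → 0ℚ ℚ.≤ p ℚ.* q
0≤p*q {p} {q} 0≤p 0≤q = subst (ℚ._≤ p ℚ.* q) (ℚ.*-zeroʳ p) (ℚ.*-monoˡ-≤-nonNeg p {{ℚ.nonNegative 0≤p}} 0≤q)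

fairCoin-isProbability : IsProbability (bernoulli ½)
fairCoin-isProbability .𝔼-nonNeg {f} 0≤f = subst (0ℚ ℚ.≤_) (sym (𝔼-fairCoin f))
  (ℚ.+-mono-≤ (0≤p*q (ℚ.nonNegative⁻¹ ½) (0≤f true)) (0≤p*q (ℚ.nonNegative⁻¹ ½) (0≤f false)))
fairCoin-isProbability .𝔼-const c = trans (𝔼-fairCoin (λ _ → c)) (½p+½p≡p c)

coins-isProbability : ∀ n → IsProbability (coins n ½)
coins-isProbability zero    = pure-isProbability []
coins-isProbability (suc n) = >>=-isProbability fairCoin-isProbability λ b →
  >>=-isProbability (coins-isProbability n) λ bs → pure-isProbability (b ∷ bs)

G-isProbability : ∀ n → IsProbability G⟨ n , ½ ⟩
G-isProbability zero    = pure-isProbability emptyGraph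
G-isProbability (suc n) = >>=-isProbability (G-isProbability n) λ G →
  >>=-isProbability (coins-isProbability n) λ s → pure-isProbability (addVertex G s)

𝔼-coins-suc : ∀ n f → 𝔼 (coins (suc n) ½) f ≡
  ½ ℚ.* 𝔼 (coins n ½) (f ∘ (true ∷_)) ℚ.+ ½ ℚ.* 𝔼 (coins n ½) (f ∘ (false ∷_))
𝔼-coins-suc n f = begin
  𝔼 (coins (suc n) ½) f
    ≡⟨ 𝔼->>= (bernoulli ½) (λ b → coins n ½ >>= λ bs → pure (b ∷ bs)) f ⟩
  𝔼 (bernoulli ½) (λ b → 𝔼 (coins n ½ >>= λ bs → pure (b ∷ bs)) f)
    ≡⟨ 𝔼-cong (bernoulli ½) (λ b → trans (𝔼->>= (coins n ½) (λ bs → pure (b ∷ bs)) f)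
         (𝔼-cong (coins n ½) λ bs → 𝔼-pure (b ∷ bs) f)) ⟩
  𝔼 (bernoulli ½) (λ b → 𝔼 (coins n ½) (f ∘ (b ∷_)))
    ≡⟨ 𝔼-fairCoin (λ b → 𝔼 (coins n ½) (f ∘ (b ∷_))) ⟩
  _ ∎
  where open ≡-Reasoning

𝔼-G-suc : ∀ n f → 𝔼 G⟨ suc n , ½ ⟩ f ≡ 𝔼 G⟨ n , ½ ⟩ (λ G → 𝔼 (coins n ½) (f ∘ addVertex G))
𝔼-G-suc n f = trans
  (𝔼->>= G⟨ n , ½ ⟩ (λ G → coins n ½ >>= λ s → pure (addVertex G s)) f)
  (𝔼-cong G⟨ n , ½ ⟩ λ G → trans (𝔼->>= (coins n ½) (λ s → pure (addVertex G s)) f)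
    (𝔼-cong (coins n ½) λ s → 𝔼-pure (addVertex G s) f))

-- miss k = 1 − 2^-k is the probability that k fair coins do not all show heads.
miss : ℕ → ℚ
miss zero    = 0ℚ
miss (suc k) = ½ ℚ.* miss k ℚ.+ ½ ℚ.* 1ℚ

-- Toss `k` further coins. Given σ ⊆ s, they fail to be all heads with probability `miss k`;
-- otherwise some coin of σ already shows tails. Together this is the event that `k + ∣ σ ∣` coins
-- are not all heads.
𝔼-⊆ : ∀ {n} k (σ : Subset n) →
  𝔼 (coins n ½) (λ s → if does (σ ⊆? s) then miss k else 1ℚ) ≡ miss (k ℕ.+ ∣ σ ∣)
𝔼-⊆ k [] = trans (𝔼-pure {Vec Bool 0} [] (λ _ → miss k)) (cong miss (sym (ℕ.+-identityʳ k)))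
𝔼-⊆ {suc n} k (inside ∷ σ) = begin
  𝔼 (coins (suc n) ½) (λ s → if does ((inside ∷ σ) ⊆? s) then miss k else 1ℚ)
    ≡⟨ 𝔼-coins-suc n _ ⟩
  ½ ℚ.* 𝔼 (coins n ½) (λ s → if does (σ ⊆? s) then miss k else 1ℚ) ℚ.+ ½ ℚ.* 𝔼 (coins n ½) (λ _ → 1ℚ)
    ≡⟨ cong₂ (λ p q → ½ ℚ.* p ℚ.+ ½ ℚ.* q) (𝔼-⊆ k σ) (𝔼-const (coins-isProbability n) 1ℚ) ⟩
  miss (suc (k ℕ.+ ∣ σ ∣))
    ≡⟨ cong miss (sym (ℕ.+-suc k ∣ σ ∣)) ⟩
  miss (k ℕ.+ suc ∣ σ ∣) ∎
  where open ≡-Reasoning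
𝔼-⊆ {suc n} k (outside ∷ σ) =
  trans (𝔼-coins-suc n _) (trans (½p+½p≡p _) (𝔼-⊆ k σ))

-- Each element of T is kept independently with probability ½ and so contributes a factor ½ ·
-- `miss k` + ½ = `miss (suc k)`.
𝔼-∩ : ∀ {n} k (T : Subset n) → 𝔼 (coins n ½) (λ s → miss k ^ ∣ s ∩ T ∣) ≡ miss (suc k) ^ ∣ T ∣
𝔼-∩ k [] = 𝔼-pure {Vec Bool 0} [] (λ _ → 1ℚ)
𝔼-∩ {suc n} k (outside ∷ T) = trans (𝔼-coins-suc n _) (trans (½p+½p≡p _) (𝔼-∩ k T))
𝔼-∩ {suc n} k (inside ∷ T) = begin
  𝔼 (coins (suc n) ½) (λ s → miss k ^ ∣ s ∩ (inside ∷ T) ∣)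
    ≡⟨ 𝔼-coins-suc n _ ⟩
  ½ ℚ.* 𝔼 (coins n ½) (λ s → miss k ℚ.* miss k ^ ∣ s ∩ T ∣) ℚ.+ ½ ℚ.* e
    ≡⟨ cong (λ p → ½ ℚ.* p ℚ.+ ½ ℚ.* e) (𝔼-*ˡ (coins n ½) (miss k) _) ⟩
  ½ ℚ.* (miss k ℚ.* e) ℚ.+ ½ ℚ.* e
    ≡⟨ solve 3 (λ h y e → h :* (y :* e) :+ h :* e := (h :* y :+ h :* con 1ℚ) :* e) refl ½ (miss k) e ⟩
  miss (suc k) ℚ.* e
    ≡⟨ cong (miss (suc k) ℚ.*_) (𝔼-∩ k T) ⟩
  miss (suc k) ^ ∣ inside ∷ T ∣ ∎
  where
  open ≡-Reasoning
  open ℚ-Solver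
  e = 𝔼 (coins n ½) (λ s → miss k ^ ∣ s ∩ T ∣)

^-∣∷∣ : ∀ {n} p b (T : Subset n) → p ^ ∣ b ∷ T ∣ ≡ (if b then p else 1ℚ) ℚ.* p ^ ∣ T ∣
^-∣∷∣ p inside  T = refl
^-∣∷∣ p outside T = sym (ℚ.*-identityˡ _)

-- Quantified over all `k` because the case of a new vertex in σ uses the induction hypothesis at
-- `suc k`. Each vertex outside σ contributes one factor: the chance that its edges to σ and `k`
-- extra coins are not all heads.
𝔼-miss^∣commonNeighbours∣ : ∀ n k (σ : Subset n) →
  𝔼 G⟨ n , ½ ⟩ (λ G → miss k ^ ∣ commonNeighbours G σ ∣) ≡ miss (k ℕ.+ ∣ σ ∣) ^ ∣ ∁ σ ∣
𝔼-miss^∣commonNeighbours∣ zero k [] = 𝔼-pure emptyGraph (λ _ → 1ℚ)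
𝔼-miss^∣commonNeighbours∣ (suc n) k (outside ∷ σ) = begin
  𝔼 G⟨ suc n , ½ ⟩ (λ G → miss k ^ ∣ commonNeighbours G (outside ∷ σ) ∣)
    ≡⟨ 𝔼-G-suc n _ ⟩
  𝔼 G⟨ n , ½ ⟩ (λ G → 𝔼 (coins n ½) λ s → miss k ^ ∣ commonNeighbours (addVertex G s) (outside ∷ σ) ∣)
    ≡⟨ 𝔼-cong G⟨ n , ½ ⟩ (λ G → trans
         (𝔼-cong (coins n ½) λ s → trans (cong (λ p → miss k ^ ∣ p ∣) (commonNeighbours-outside G s σ))
                                          (^-∣∷∣ (miss k) (does (σ ⊆? s)) (commonNeighbours G σ)))
         (trans (𝔼-*ʳ (coins n ½) (miss k ^ ∣ commonNeighbours G σ ∣) _)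
                (cong (ℚ._* miss k ^ ∣ commonNeighbours G σ ∣) (𝔼-⊆ k σ)))) ⟩
  𝔼 G⟨ n , ½ ⟩ (λ G → miss (k ℕ.+ ∣ σ ∣) ℚ.* miss k ^ ∣ commonNeighbours G σ ∣)
    ≡⟨ 𝔼-*ˡ G⟨ n , ½ ⟩ (miss (k ℕ.+ ∣ σ ∣)) _ ⟩
  miss (k ℕ.+ ∣ σ ∣) ℚ.* 𝔼 G⟨ n , ½ ⟩ (λ G → miss k ^ ∣ commonNeighbours G σ ∣)
    ≡⟨ cong (miss (k ℕ.+ ∣ σ ∣) ℚ.*_) (𝔼-miss^∣commonNeighbours∣ n k σ) ⟩
  miss (k ℕ.+ ∣ σ ∣) ^ suc ∣ ∁ σ ∣ ∎
  where open ≡-Reasoning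
𝔼-miss^∣commonNeighbours∣ (suc n) k (inside ∷ σ) = begin
  𝔼 G⟨ suc n , ½ ⟩ (λ G → miss k ^ ∣ commonNeighbours G (inside ∷ σ) ∣)
    ≡⟨ 𝔼-G-suc n _ ⟩
  𝔼 G⟨ n , ½ ⟩ (λ G → 𝔼 (coins n ½) λ s → miss k ^ ∣ commonNeighbours (addVertex G s) (inside ∷ σ) ∣)
    ≡⟨ 𝔼-cong G⟨ n , ½ ⟩ (λ G → trans
         (𝔼-cong (coins n ½) λ s → cong (λ p → miss k ^ ∣ p ∣) (commonNeighbours-inside G s σ))
         (𝔼-∩ k (commonNeighbours G σ))) ⟩
  𝔼 G⟨ n , ½ ⟩ (λ G → miss (suc k) ^ ∣ commonNeighbours G σ ∣)
    ≡⟨ 𝔼-miss^∣commonNeighbours∣ n (suc k) σ ⟩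
  miss (suc k ℕ.+ ∣ σ ∣) ^ ∣ ∁ σ ∣
    ≡⟨ cong (λ j → miss j ^ ∣ ∁ σ ∣) (sym (ℕ.+-suc k ∣ σ ∣)) ⟩
  miss (k ℕ.+ suc ∣ σ ∣) ^ ∣ ∁ σ ∣ ∎
  where open ≡-Reasoning

-- The union bound

Pr≡𝔼 : ∀ {A} (D : Dist A) E → Pr D E ≡ 𝔼 D (λ a → if E a then 1ℚ else 0ℚ)
Pr≡𝔼 []            E = refl
Pr≡𝔼 ((a , u) ∷ D) E with E a
... | true  = cong₂ ℚ._+_ (sym (ℚ.*-identityʳ u)) (Pr≡𝔼 D E)
... | false = trans (Pr≡𝔼 D E) (trans (sym (ℚ.+-identityˡ _)) (cong (ℚ._+ _) (sym (ℚ.*-zeroʳ u))))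

-- Pointwise `1 - S` is at most the indicator of `S < 1`: it is at most 1 since `S ≥ 0`, and at most
-- 0 where `S ≥ 1`.
markov : ∀ {A} {D : Dist A} → IsProbability D → ∀ {S : A → ℚ} → (∀ a → 0ℚ ℚ.≤ S a) →
  1ℚ ℚ.- 𝔼 D S ℚ.≤ Pr D (λ a → ⌊ S a ℚ.<? 1ℚ ⌋)
markov {D = D} pD {S} 0≤S = begin
  1ℚ ℚ.- 𝔼 D S                                      ≡⟨ sym (𝔼-complement pD S) ⟩
  𝔼 D (λ a → 1ℚ ℚ.- S a)                            ≤⟨ 𝔼-mono pD (λ a → pointwise (0≤S a) (S a ℚ.<? 1ℚ)) ⟩
  𝔼 D (λ a → if ⌊ S a ℚ.<? 1ℚ ⌋ then 1ℚ else 0ℚ) ≡⟨ sym (Pr≡𝔼 D _) ⟩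
  Pr D (λ a → ⌊ S a ℚ.<? 1ℚ ⌋)                   ∎
  where
  open ℚ.≤-Reasoning
  pointwise : ∀ {s} → 0ℚ ℚ.≤ s → (s<1? : Dec (s ℚ.< 1ℚ)) →
    1ℚ ℚ.- s ℚ.≤ (if ⌊ s<1? ⌋ then 1ℚ else 0ℚ)
  pointwise 0≤s (yes _)   = ℚ.+-monoʳ-≤ 1ℚ (ℚ.neg-antimono-≤ 0≤s)
  pointwise 0≤s (no  s≮1) = ℚ.+-monoʳ-≤ 1ℚ (ℚ.neg-antimono-≤ (ℚ.≮⇒≥ s≮1))

Σ[_]_ : ∀ {B : Set} → List B → (B → ℚ) → ℚ
Σ[ []     ] f = 0ℚ
Σ[ b ∷ bs ] f = f b ℚ.+ Σ[ bs ] f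

Σ-nonNeg : ∀ {B} (bs : List B) {f} → (∀ b → 0ℚ ℚ.≤ f b) → 0ℚ ℚ.≤ Σ[ bs ] f
Σ-nonNeg []       0≤f = ℚ.≤-refl
Σ-nonNeg (b ∷ bs) 0≤f = ℚ.+-mono-≤ (0≤f b) (Σ-nonNeg bs 0≤f)

term≤Σ : ∀ {B} {bs : List B} {f b} → (∀ b → 0ℚ ℚ.≤ f b) → b ∈ bs → f b ℚ.≤ Σ[ bs ] f
term≤Σ {bs = b ∷ bs} {f} 0≤f (here refl) =
  subst (ℚ._≤ f b ℚ.+ Σ[ bs ] f) (ℚ.+-identityʳ (f b)) (ℚ.+-monoʳ-≤ (f b) (Σ-nonNeg bs 0≤f))
term≤Σ {bs = b ∷ bs} {f} {b′} 0≤f (there b′∈bs) =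
  subst (ℚ._≤ f b ℚ.+ Σ[ bs ] f) (ℚ.+-identityˡ (f b′)) (ℚ.+-mono-≤ (0≤f b) (term≤Σ 0≤f b′∈bs))

𝔼-Σ : ∀ {A B} {D : Dist A} → IsProbability D → {bs : List B} {f : B → A → ℚ} {c : ℚ} →
  All (λ b → 𝔼 D (f b) ≡ c) bs → 𝔼 D (λ a → Σ[ bs ] λ b → f b a) ≡ length bs × c
𝔼-Σ pD []         = 𝔼-const pD 0ℚ
𝔼-Σ {D = D} pD {b ∷ bs} {f} (e ∷ es) =
  trans (𝔼-+ D (f b) (λ a → Σ[ bs ] λ b → f b a)) (cong₂ ℚ._+_ e (𝔼-Σ pD es))

𝔼-× : ∀ {A} (D : Dist A) N f → 𝔼 D (λ a → N × f a) ≡ N × 𝔼 D f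
𝔼-× []            zero    f = refl
𝔼-× ((a , u) ∷ D) zero    f = trans (cong₂ ℚ._+_ (ℚ.*-zeroʳ u) (𝔼-× D 0 f)) (ℚ.+-identityˡ 0ℚ)
𝔼-× D             (suc N) f = trans (𝔼-+ D f (λ a → N × f a)) (cong (𝔼 D f ℚ.+_) (𝔼-× D N f))

subsetsOfSize : ∀ n → ℕ → List (Subset n)
subsetsOfSize n       zero    = ⊥ ∷ []
subsetsOfSize zero    (suc l) = []
subsetsOfSize (suc n) (suc l) =
  List.map (inside ∷_) (subsetsOfSize n l) ++ List.map (outside ∷_) (subsetsOfSize n (suc l))

∈-subsetsOfSize : ∀ {n} (σ : Subset n) → σ ∈ subsetsOfSize n ∣ σ ∣
∈-subsetsOfSize []            = here refl
∈-subsetsOfSize (inside  ∷ σ) = ∈-++⁺ˡ (∈-map⁺ (inside ∷_) (∈-subsetsOfSize σ))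
∈-subsetsOfSize (outside ∷ σ) with ∣ σ ∣ | ∈-subsetsOfSize σ
... | zero  | here refl = here refl
... | suc l | σ∈        = ∈-++⁺ʳ (List.map (inside ∷_) (subsetsOfSize _ l)) (∈-map⁺ (outside ∷_) σ∈)

∣subsetsOfSize∣ : ∀ n l → All (λ σ → ∣ σ ∣ ≡ l) (subsetsOfSize n l)
∣subsetsOfSize∣ n       zero    = ∣⊥∣≡0 n ∷ []
∣subsetsOfSize∣ zero    (suc l) = []
∣subsetsOfSize∣ (suc n) (suc l) = All.++⁺
  (All.map⁺ (All.map (cong suc) (∣subsetsOfSize∣ n l)))
  (All.map⁺ (∣subsetsOfSize∣ n (suc l)))

-- The two halves of Pascal's recurrence give at most n^l + n^(l + 1) = (n + 1) n^l, which is at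
-- most (n + 1)^(l + 1).
length-subsetsOfSize : ∀ n l → length (subsetsOfSize n l) ℕ.≤ n ℕ.^ l
length-subsetsOfSize n       zero    = ℕ.≤-refl
length-subsetsOfSize zero    (suc l) = z≤n
length-subsetsOfSize (suc n) (suc l) = begin
  length (List.map (inside ∷_) (subsetsOfSize n l) ++ List.map (outside ∷_) (subsetsOfSize n (suc l)))
    ≡⟨ length-++ (List.map (inside ∷_) (subsetsOfSize n l)) ⟩
  length (List.map (inside ∷_) (subsetsOfSize n l)) ℕ.+ length (List.map (outside ∷_) (subsetsOfSize n (suc l)))
    ≡⟨ cong₂ ℕ._+_ (length-map (inside ∷_) (subsetsOfSize n l)) (length-map (outside ∷_) (subsetsOfSize n (suc l))) ⟩
  length (subsetsOfSize n l) ℕ.+ length (subsetsOfSize n (suc l))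
    ≤⟨ ℕ.+-mono-≤ (length-subsetsOfSize n l) (length-subsetsOfSize n (suc l)) ⟩
  suc n ℕ.* n ℕ.^ l
    ≤⟨ ℕ.*-monoʳ-≤ (suc n) (ℕ.^-monoˡ-≤ l (ℕ.n≤1+n n)) ⟩
  suc n ℕ.^ suc l ∎
  where open ℕ.≤-Reasoning

-- Powers of ½ and of `miss k`

×-nonNeg : ∀ N {q} → 0ℚ ℚ.≤ q → 0ℚ ℚ.≤ N × q
×-nonNeg zero    0≤q = ℚ.≤-refl
×-nonNeg (suc N) 0≤q = ℚ.+-mono-≤ 0≤q (×-nonNeg N 0≤q)

×-monoˡ-≤ : ∀ {M N q} → 0ℚ ℚ.≤ q → M ℕ.≤ N → M × q ℚ.≤ N × q
×-monoˡ-≤ {N = N} 0≤q z≤n = ×-nonNeg N 0≤q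
×-monoˡ-≤ {q = q} 0≤q (s≤s M≤N) = ℚ.+-monoʳ-≤ q (×-monoˡ-≤ 0≤q M≤N)

×-monoʳ-≤ : ∀ N {p q} → p ℚ.≤ q → N × p ℚ.≤ N × q
×-monoʳ-≤ zero    p≤q = ℚ.≤-refl
×-monoʳ-≤ (suc N) p≤q = ℚ.+-mono-≤ p≤q (×-monoʳ-≤ N p≤q)

^-nonNeg : ∀ {p} n → 0ℚ ℚ.≤ p → 0ℚ ℚ.≤ p ^ n
^-nonNeg zero    0≤p = ℚ.nonNegative⁻¹ 1ℚ
^-nonNeg (suc n) 0≤p = 0≤p*q 0≤p (^-nonNeg n 0≤p)

*-mono-≤-nonNeg : ∀ {p q r s} → 0ℚ ℚ.≤ p → 0ℚ ℚ.≤ s → p ℚ.≤ q → r ℚ.≤ s → p ℚ.* r ℚ.≤ q ℚ.* s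
*-mono-≤-nonNeg {p} {q} {r} {s} 0≤p 0≤s p≤q r≤s = ℚ.≤-trans
  (ℚ.*-monoˡ-≤-nonNeg p {{ℚ.nonNegative 0≤p}} r≤s)
  (ℚ.*-monoʳ-≤-nonNeg s {{ℚ.nonNegative 0≤s}} p≤q)

^-monoˡ-≤-nonNeg : ∀ n {p q} → 0ℚ ℚ.≤ p → p ℚ.≤ q → p ^ n ℚ.≤ q ^ n
^-monoˡ-≤-nonNeg zero    0≤p p≤q = ℚ.≤-refl
^-monoˡ-≤-nonNeg (suc n) 0≤p p≤q =
  *-mono-≤-nonNeg 0≤p (^-nonNeg n (ℚ.≤-trans 0≤p p≤q)) p≤q (^-monoˡ-≤-nonNeg n 0≤p p≤q)

^-antimonoʳ-≤ : ∀ {p m n} → 0ℚ ℚ.≤ p → p ℚ.≤ 1ℚ → m ℕ.≤ n → p ^ n ℚ.≤ p ^ m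
^-antimonoʳ-≤ {n = zero}  0≤p p≤1 z≤n = ℚ.≤-refl
^-antimonoʳ-≤ {n = suc n} 0≤p p≤1 z≤n =
  *-mono-≤-nonNeg 0≤p (ℚ.nonNegative⁻¹ 1ℚ) p≤1 (^-antimonoʳ-≤ 0≤p p≤1 (z≤n {n}))
^-antimonoʳ-≤ {p} 0≤p p≤1 (s≤s m≤n) =
  ℚ.*-monoˡ-≤-nonNeg p {{ℚ.nonNegative 0≤p}} (^-antimonoʳ-≤ 0≤p p≤1 m≤n)

0≤½^ : ∀ n → 0ℚ ℚ.≤ ½ ^ n
0≤½^ n = ^-nonNeg n (ℚ.nonNegative⁻¹ ½)

2×½*p≡p : ∀ p → 2 × (½ ℚ.* p) ≡ p
2×½*p≡p p = trans (cong (½ ℚ.* p ℚ.+_) (ℚ.+-identityʳ (½ ℚ.* p))) (½p+½p≡p p)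

2^a×½^[a+b]≡½^b : ∀ a b → (2 ℕ.^ a) × (½ ^ (a ℕ.+ b)) ≡ ½ ^ b
2^a×½^[a+b]≡½^b zero    b = ℚ.+-identityʳ (½ ^ b)
2^a×½^[a+b]≡½^b (suc a) b = begin
  (2 ℕ.* 2 ℕ.^ a) × (½ ℚ.* ½ ^ (a ℕ.+ b))   ≡⟨ cong (_× (½ ℚ.* ½ ^ (a ℕ.+ b))) (ℕ.*-comm 2 (2 ℕ.^ a)) ⟩
  (2 ℕ.^ a ℕ.* 2) × (½ ℚ.* ½ ^ (a ℕ.+ b))   ≡⟨ sym (×-assocˡ (½ ℚ.* ½ ^ (a ℕ.+ b)) (2 ℕ.^ a) 2) ⟩
  (2 ℕ.^ a) × (2 × (½ ℚ.* ½ ^ (a ℕ.+ b)))   ≡⟨ cong ((2 ℕ.^ a) ×_) (2×½*p≡p (½ ^ (a ℕ.+ b))) ⟩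
  (2 ℕ.^ a) × (½ ^ (a ℕ.+ b))               ≡⟨ 2^a×½^[a+b]≡½^b a b ⟩
  ½ ^ b                                     ∎
  where open ≡-Reasoning

2^a×½^a≡1 : ∀ a → (2 ℕ.^ a) × (½ ^ a) ≡ 1ℚ
2^a×½^a≡1 a = trans (cong (λ i → (2 ℕ.^ a) × (½ ^ i)) (sym (ℕ.+-identityʳ a))) (2^a×½^[a+b]≡½^b a 0)

miss≡1-½^ : ∀ k → miss k ≡ 1ℚ ℚ.- ½ ^ k
miss≡1-½^ zero    = refl
miss≡1-½^ (suc k) = trans (cong (λ p → ½ ℚ.* p ℚ.+ ½ ℚ.* 1ℚ) (miss≡1-½^ k))
  (trans (solve 2 (λ h y → h :* (con 1ℚ :- y) :+ h :* con 1ℚ := (h :* con 1ℚ :+ h :* con 1ℚ) :- h :* y) refl ½ (½ ^ k))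
         (cong (ℚ._- ½ ℚ.* ½ ^ k) (½p+½p≡p 1ℚ)))
  where open ℚ-Solver

0≤miss : ∀ k → 0ℚ ℚ.≤ miss k
0≤miss zero    = ℚ.≤-refl
0≤miss (suc k) = ℚ.+-mono-≤ (0≤p*q (ℚ.nonNegative⁻¹ ½) (0≤miss k)) (ℚ.nonNegative⁻¹ (½ ℚ.* 1ℚ))

miss≤1 : ∀ k → miss k ℚ.≤ 1ℚ
miss≤1 k = subst (ℚ._≤ 1ℚ) (sym (miss≡1-½^ k)) (ℚ.+-monoʳ-≤ 1ℚ (ℚ.neg-antimono-≤ (0≤½^ k)))

-- Bernoulli's inequality without division, bounding (1 - y)^N by 1 / (1 + N y). With z = N y, the
-- induction step rests on (1 - y)(1 + y + z) = 1 + z - y (y + z) ≤ 1 + z.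
bernoulli-≤ : ∀ {y} → 0ℚ ℚ.≤ y → 0ℚ ℚ.≤ 1ℚ ℚ.- y → ∀ N → (1ℚ ℚ.- y) ^ N ℚ.* (1ℚ ℚ.+ N × y) ℚ.≤ 1ℚ
bernoulli-≤ {y} 0≤y 0≤1-y zero    = ℚ.≤-refl
bernoulli-≤ {y} 0≤y 0≤1-y (suc N) = begin
  (p ℚ.* p ^ N) ℚ.* (1ℚ ℚ.+ (y ℚ.+ z))
    ≡⟨ solve 3 (λ y z P → ((con 1ℚ :- y) :* P) :* (con 1ℚ :+ (y :+ z)) := P :* ((con 1ℚ :+ z) :- y :* (y :+ z)))
         refl y z (p ^ N) ⟩
  p ^ N ℚ.* ((1ℚ ℚ.+ z) ℚ.- y ℚ.* (y ℚ.+ z))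
    ≤⟨ ℚ.*-monoˡ-≤-nonNeg (p ^ N) {{ℚ.nonNegative (^-nonNeg N 0≤1-y)}}
         (ℚ.+-monoʳ-≤ (1ℚ ℚ.+ z) (ℚ.neg-antimono-≤ (0≤p*q 0≤y (ℚ.+-mono-≤ 0≤y (×-nonNeg N 0≤y))))) ⟩
  p ^ N ℚ.* ((1ℚ ℚ.+ z) ℚ.- 0ℚ)
    ≡⟨ cong (p ^ N ℚ.*_) (ℚ.+-identityʳ (1ℚ ℚ.+ z)) ⟩
  p ^ N ℚ.* (1ℚ ℚ.+ z)
    ≤⟨ bernoulli-≤ 0≤y 0≤1-y N ⟩
  1ℚ ∎
  where
  open ℚ.≤-Reasoning
  open ℚ-Solver
  p = 1ℚ ℚ.- y
  z = N × y

-- `bernoulli-≤` with y = 2^-k and N = 2^k, where 1 + N y = 2.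
miss^2^k≤½ : ∀ k → miss k ^ (2 ℕ.^ k) ℚ.≤ ½
miss^2^k≤½ k = begin
  q                              ≡⟨ sym (½p+½p≡p q) ⟩
  ½ ℚ.* q ℚ.+ ½ ℚ.* q            ≡⟨ solve 2 (λ h q → h :* q :+ h :* q := h :* (q :* (con 1ℚ :+ con 1ℚ))) refl ½ q ⟩
  ½ ℚ.* (q ℚ.* (1ℚ ℚ.+ 1ℚ))      ≤⟨ ℚ.*-monoˡ-≤-nonNeg ½ q*2≤1 ⟩
  ½ ℚ.* 1ℚ                       ≡⟨⟩
  ½                              ∎
  where
  open ℚ.≤-Reasoning
  open ℚ-Solver
  q = miss k ^ (2 ℕ.^ k)
  q*2≤1 : q ℚ.* (1ℚ ℚ.+ 1ℚ) ℚ.≤ 1ℚ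
  q*2≤1 = subst₂ (λ u v → u ^ (2 ℕ.^ k) ℚ.* (1ℚ ℚ.+ v) ℚ.≤ 1ℚ) (sym (miss≡1-½^ k)) (2^a×½^a≡1 k)
    (bernoulli-≤ (0≤½^ k) (subst (0ℚ ℚ.≤_) (miss≡1-½^ k) (0≤miss k)) (2 ℕ.^ k))

miss^N≤½^t : ∀ k {t N} → 2 ℕ.^ k ℕ.* t ℕ.≤ N → miss k ^ N ℚ.≤ ½ ^ t
miss^N≤½^t k {t} {N} 2^k*t≤N = begin
  miss k ^ N                ≤⟨ ^-antimonoʳ-≤ (0≤miss k) (miss≤1 k) 2^k*t≤N ⟩
  miss k ^ (2 ℕ.^ k ℕ.* t)  ≡⟨ sym (^-assocʳ (miss k) (2 ℕ.^ k) t) ⟩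
  (miss k ^ (2 ℕ.^ k)) ^ t  ≤⟨ ^-monoˡ-≤-nonNeg t (^-nonNeg (2 ℕ.^ k) (0≤miss k)) (miss^2^k≤½ k) ⟩
  ½ ^ t                  ∎
  where open ℚ.≤-Reasoning

-- Exponential moment bound for sets with too few common neighbours

defect : ∀ {n} → ℕ → ℕ → Graph n → ℚ
defect {n} m l G = Σ[ subsetsOfSize n l ] λ σ → (2 ℕ.^ m) × (½ ^ ∣ commonNeighbours G σ ∣)

0≤defectTerm : ∀ {n} m (G : Graph n) σ → 0ℚ ℚ.≤ (2 ℕ.^ m) × (½ ^ ∣ commonNeighbours G σ ∣)
0≤defectTerm m G σ = ×-nonNeg (2 ℕ.^ m) (0≤½^ ∣ commonNeighbours G σ ∣)

-- A set with X < m common neighbours alone contributes 2^m · 2^-X ≥ 1 to a sum of nonnegative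
-- terms. This weight lets the exact expectation of ½^X serve in Markov's inequality.
defect<1⇒m≤∣commonNeighbours∣ : ∀ {n} m (G : Graph n) σ → defect m ∣ σ ∣ G ℚ.< 1ℚ →
  m ℕ.≤ ∣ commonNeighbours G σ ∣
defect<1⇒m≤∣commonNeighbours∣ m G σ defect<1 with m ℕ.≤? ∣ commonNeighbours G σ ∣
... | yes m≤X = m≤X
... | no  m≰X = ⊥-elim (ℚ.<-irrefl refl (ℚ.≤-<-trans (begin
  1ℚ                     ≡⟨ sym (2^a×½^a≡1 X) ⟩
  (2 ℕ.^ X) × (½ ^ X)    ≤⟨ ×-monoˡ-≤ (0≤½^ X) (ℕ.^-monoʳ-≤ 2 (ℕ.<⇒≤ (ℕ.≰⇒> m≰X))) ⟩
  (2 ℕ.^ m) × (½ ^ X)    ≤⟨ term≤Σ (0≤defectTerm m G) (∈-subsetsOfSize σ) ⟩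
  defect m ∣ σ ∣ G       ∎) defect<1))
  where
  open ℚ.≤-Reasoning
  X = ∣ commonNeighbours G σ ∣

𝔼-defect : ∀ n m l →
  𝔼 G⟨ n , ½ ⟩ (defect m l) ≡ length (subsetsOfSize n l) × ((2 ℕ.^ m) × (miss (suc l) ^ (n ℕ.∸ l)))
𝔼-defect n m l = 𝔼-Σ (G-isProbability n) (All.map expectation (∣subsetsOfSize∣ n l))
  where
  open ≡-Reasoning
  expectation : ∀ {σ} → ∣ σ ∣ ≡ l →
    𝔼 G⟨ n , ½ ⟩ (λ G → (2 ℕ.^ m) × (½ ^ ∣ commonNeighbours G σ ∣)) ≡ (2 ℕ.^ m) × (miss (suc l) ^ (n ℕ.∸ l))
  expectation {σ} refl = begin
    -- `½` is replaced by `miss 1`, which computes to it.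
    𝔼 G⟨ n , ½ ⟩ (λ G → (2 ℕ.^ m) × (miss 1 ^ ∣ commonNeighbours G σ ∣))
      ≡⟨ 𝔼-× G⟨ n , ½ ⟩ (2 ℕ.^ m) (λ G → miss 1 ^ ∣ commonNeighbours G σ ∣) ⟩
    (2 ℕ.^ m) × 𝔼 G⟨ n , ½ ⟩ (λ G → miss 1 ^ ∣ commonNeighbours G σ ∣)
      ≡⟨ cong ((2 ℕ.^ m) ×_) (𝔼-miss^∣commonNeighbours∣ n 1 σ) ⟩
    (2 ℕ.^ m) × (miss (suc ∣ σ ∣) ^ ∣ ∁ σ ∣)
      ≡⟨ cong (λ i → (2 ℕ.^ m) × (miss (suc ∣ σ ∣) ^ i)) (∣∁p∣≡n∸∣p∣ σ) ⟩
    (2 ℕ.^ m) × (miss (suc ∣ σ ∣) ^ (n ℕ.∸ ∣ σ ∣)) ∎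

-- `2 ^ a` bounds the number of sets, `2 ^ m` is the weight in `defect`, and `½ ^ d` is the target,
-- so the power of `miss (suc l)` must drop to `½ ^ (a + m + d)`. As 2^(l + 1) factors are worth one
-- halving, it suffices that n - l reaches 2^(l + 1) · (a + m + d).
𝔼-defect-small : ∀ n m l a d → n ℕ.^ l ℕ.≤ 2 ℕ.^ a →
  2 ℕ.^ suc l ℕ.* (a ℕ.+ m ℕ.+ d) ℕ.+ l ℕ.≤ n → 𝔼 G⟨ n , ½ ⟩ (defect m l) ℚ.≤ ½ ^ d
𝔼-defect-small n m l a d n^l≤2^a big = begin
  𝔼 G⟨ n , ½ ⟩ (defect m l)
    ≡⟨ 𝔼-defect n m l ⟩
  length (subsetsOfSize n l) × ((2 ℕ.^ m) × p)
    ≡⟨ ×-assocˡ p (length (subsetsOfSize n l)) (2 ℕ.^ m) ⟩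
  (length (subsetsOfSize n l) ℕ.* 2 ℕ.^ m) × p
    ≤⟨ ×-monoˡ-≤ (^-nonNeg (n ℕ.∸ l) (0≤miss (suc l)))
         (ℕ.*-monoˡ-≤ (2 ℕ.^ m) (ℕ.≤-trans (length-subsetsOfSize n l) n^l≤2^a)) ⟩
  (2 ℕ.^ a ℕ.* 2 ℕ.^ m) × p
    ≡⟨ cong (_× p) (sym (ℕ.^-distribˡ-+-* 2 a m)) ⟩
  (2 ℕ.^ (a ℕ.+ m)) × p
    ≤⟨ ×-monoʳ-≤ (2 ℕ.^ (a ℕ.+ m)) (miss^N≤½^t (suc l) (ℕ.m+n≤o⇒m≤o∸n _ big)) ⟩
  (2 ℕ.^ (a ℕ.+ m)) × (½ ^ (a ℕ.+ m ℕ.+ d))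
    ≡⟨ 2^a×½^[a+b]≡½^b (a ℕ.+ m) d ⟩
  ½ ^ d ∎
  where
  open ℚ.≤-Reasoning
  p = miss (suc l) ^ (n ℕ.∸ l)

-- Growth of l

^-cancelˡ-≤ : ∀ k {a b} → a ℕ.^ suc k ℕ.≤ b ℕ.^ suc k → a ℕ.≤ b
^-cancelˡ-≤ k {a} {b} a^≤b^ with a ℕ.≤? b
... | yes a≤b = a≤b
... | no  a≰b = ⊥-elim (ℕ.<-irrefl refl (ℕ.<-≤-trans (ℕ.^-monoˡ-< (suc k) (ℕ.≰⇒> a≰b)) a^≤b^))

^-distribʳ-* : ∀ m n k → (m ℕ.* n) ℕ.^ k ≡ m ℕ.^ k ℕ.* n ℕ.^ k
^-distribʳ-* m n zero    = refl
^-distribʳ-* m n (suc k) = trans (cong (m ℕ.* n ℕ.*_) (^-distribʳ-* m n k))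
  (solve 4 (λ m n a b → (m :* n) :* (a :* b) := (m :* a) :* (n :* b)) refl m n (m ℕ.^ k) (n ℕ.^ k))
  where open ℕ-Solver

suc≤2^ : ∀ n → suc n ℕ.≤ 2 ℕ.^ n
suc≤2^ zero    = ℕ.≤-refl
suc≤2^ (suc n) = begin
  1 ℕ.+ suc n           ≤⟨ ℕ.+-mono-≤ (ℕ.m^n>0 2 n) (suc≤2^ n) ⟩
  2 ℕ.^ n ℕ.+ 2 ℕ.^ n   ≡⟨ cong (2 ℕ.^ n ℕ.+_) (sym (ℕ.+-identityʳ (2 ℕ.^ n))) ⟩
  2 ℕ.^ suc n           ∎
  where open ℕ.≤-Reasoning

-- At q = 3 s the bound passes through (s + 1)^3 ≤ (2^s)^3. From there each step adds s on the left,
-- at most the left side itself and hence at most 2^q, while the right side doubles.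
linear≤2^ : ∀ s j → s ℕ.* suc (3 ℕ.* s ℕ.+ j) ℕ.≤ 2 ℕ.^ (3 ℕ.* s ℕ.+ j)
linear≤2^ s zero = begin
  s ℕ.* suc (3 ℕ.* s ℕ.+ 0)
    ≤⟨ ℕ.m≤m+n _ (s ℕ.* s ℕ.* s ℕ.+ 2 ℕ.* s ℕ.+ 1) ⟩
  s ℕ.* suc (3 ℕ.* s ℕ.+ 0) ℕ.+ (s ℕ.* s ℕ.* s ℕ.+ 2 ℕ.* s ℕ.+ 1)
    ≡⟨ solve 1 (λ s → s :* (con 1 :+ (con 3 :* s :+ con 0)) :+ (s :* s :* s :+ con 2 :* s :+ con 1)
                   := (con 1 :+ s) :* ((con 1 :+ s) :* ((con 1 :+ s) :* con 1))) refl s ⟩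
  suc s ℕ.^ 3
    ≤⟨ ℕ.^-monoˡ-≤ 3 (suc≤2^ s) ⟩
  (2 ℕ.^ s) ℕ.^ 3
    ≡⟨ ℕ.^-*-assoc 2 s 3 ⟩
  2 ℕ.^ (s ℕ.* 3)
    ≡⟨ cong (2 ℕ.^_) (trans (ℕ.*-comm s 3) (sym (ℕ.+-identityʳ (3 ℕ.* s)))) ⟩
  2 ℕ.^ (3 ℕ.* s ℕ.+ 0) ∎
  where open ℕ.≤-Reasoning
        open ℕ-Solver
linear≤2^ s (suc j) = begin
  s ℕ.* suc (3 ℕ.* s ℕ.+ suc j)      ≡⟨ cong (λ q → s ℕ.* suc q) (ℕ.+-suc (3 ℕ.* s) j) ⟩
  s ℕ.* suc (suc q)                  ≡⟨ ℕ.*-suc s (suc q) ⟩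
  s ℕ.+ s ℕ.* suc q                  ≤⟨ ℕ.+-mono-≤ (ℕ.≤-trans (ℕ.m≤m*n s (suc q)) (linear≤2^ s j)) (linear≤2^ s j) ⟩
  2 ℕ.^ q ℕ.+ 2 ℕ.^ q                ≡⟨ cong (2 ℕ.^ q ℕ.+_) (sym (ℕ.+-identityʳ (2 ℕ.^ q))) ⟩
  2 ℕ.^ suc q                        ≡⟨ cong (2 ℕ.^_) (sym (ℕ.+-suc (3 ℕ.* s) j)) ⟩
  2 ℕ.^ (3 ℕ.* s ℕ.+ suc j)          ∎
  where
  open ℕ.≤-Reasoning
  q = 3 ℕ.* s ℕ.+ j

-- Write q = n / k, rounded down. Then n + c ≤ (k + c)(q + 1), which `linear≤2^` bounds by 2^q once
-- q ≥ 3 (k + c); the threshold for n guarantees this. The k-th power is then at most 2^(q k) ≤ 2^n.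
[n+c]^k≤2^n : ∀ k .{{_ : ℕ.NonZero k}} c → ∃[ N ] (∀ {n} → N ℕ.≤ n → (n ℕ.+ c) ℕ.^ k ℕ.≤ 2 ℕ.^ n)
[n+c]^k≤2^n k c = 3 ℕ.* s ℕ.* k , λ {n} N≤n →
  let q     = n ℕ./ k
      3s≤q  = subst (ℕ._≤ q) (ℕ.m*n/n≡m (3 ℕ.* s) k) (ℕ./-monoˡ-≤ k N≤n)
      open ℕ.≤-Reasoning
  in begin
  (n ℕ.+ c) ℕ.^ k                        ≡⟨ cong (λ i → (i ℕ.+ c) ℕ.^ k) (ℕ.m≡m%n+[m/n]*n n k) ⟩
  (n ℕ.% k ℕ.+ q ℕ.* k ℕ.+ c) ℕ.^ k      ≤⟨ ℕ.^-monoˡ-≤ k (ℕ.+-mono-≤ (ℕ.+-monoˡ-≤ (q ℕ.* k) (ℕ.<⇒≤ (ℕ.m%n<n n k))) (ℕ.m≤m*n c (suc q))) ⟩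
  (suc q ℕ.* k ℕ.+ c ℕ.* suc q) ℕ.^ k    ≡⟨ cong (ℕ._^ k) (solve 3 (λ k q c → q :* k :+ c :* q := (k :+ c) :* q) refl k (suc q) c) ⟩
  (s ℕ.* suc q) ℕ.^ k                    ≤⟨ ℕ.^-monoˡ-≤ k (subst (λ i → s ℕ.* suc i ℕ.≤ 2 ℕ.^ i) (ℕ.m+[n∸m]≡n 3s≤q) (linear≤2^ s (q ℕ.∸ 3 ℕ.* s))) ⟩
  (2 ℕ.^ q) ℕ.^ k                        ≡⟨ ℕ.^-*-assoc 2 q k ⟩
  2 ℕ.^ (q ℕ.* k)                        ≤⟨ ℕ.^-monoʳ-≤ 2 (ℕ.m/n*n≤m n k) ⟩
  2 ℕ.^ n                                ∎
  where
  s = k ℕ.+ c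
  open ℕ-Solver

^*suc≤⇒≤ : ∀ r {b c n} → b ℕ.^ suc r ℕ.≤ c ℕ.* n ℕ.^ r → c ℕ.≤ n → b ℕ.≤ n
^*suc≤⇒≤ r {n = n} b^≤ c≤n = ^-cancelˡ-≤ r (ℕ.≤-trans b^≤ (ℕ.*-monoˡ-≤ (n ℕ.^ r) c≤n))

-- With M = ⌊log₂ n⌋ + m + d + 2, the left side is at most K M² for K = 2^(l + 1). Its (r + 1)-th
-- power is at most 2^(r + 2) M^(2 (r + 1)) n^r: r + 1 factors 2 come from K and one from the
-- hypothesis on l. As 2 ≤ M, they are absorbed into M^((r + 2) + 2 (r + 1)), which the hypothesis
-- on M replaces by 2^⌊log₂ n⌋ ≤ n.
skeleton-room : ∀ r m d n l → 2 ℕ.≤ n →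
  (⌊log₂ n ⌋ ℕ.+ (m ℕ.+ d ℕ.+ 2)) ℕ.^ (suc (suc r) ℕ.+ 2 ℕ.* suc r) ℕ.≤ 2 ℕ.^ ⌊log₂ n ⌋ →
  (2 ℕ.^ l) ℕ.^ suc r ℕ.≤ 2 ℕ.* n ℕ.^ r →
  2 ℕ.^ suc l ℕ.* (suc ⌊log₂ n ⌋ ℕ.* l ℕ.+ m ℕ.+ d) ℕ.+ l ℕ.≤ n
skeleton-room r m d n l 2≤n M^≤ 2^l≤ = begin
  K ℕ.* P ℕ.+ l                       ≤⟨ ℕ.+-monoʳ-≤ (K ℕ.* P) (ℕ.m≤n*m l K {{ℕ.m^n≢0 2 (suc l)}}) ⟩
  K ℕ.* P ℕ.+ K ℕ.* l                 ≡⟨ sym (ℕ.*-distribˡ-+ K P l) ⟩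
  K ℕ.* (P ℕ.+ l)                     ≤⟨ ℕ.*-monoʳ-≤ K P+l≤M² ⟩
  K ℕ.* (M ℕ.^ 2)                     ≤⟨ ^*suc≤⇒≤ r (begin
    (K ℕ.* M ℕ.^ 2) ℕ.^ suc r
      ≡⟨ trans (^-distribʳ-* K (M ℕ.^ 2) (suc r))
               (cong₂ ℕ._*_ (^-distribʳ-* 2 (2 ℕ.^ l) (suc r)) (ℕ.^-*-assoc M 2 (suc r))) ⟩
    2 ℕ.^ suc r ℕ.* (2 ℕ.^ l) ℕ.^ suc r ℕ.* M ℕ.^ (2 ℕ.* suc r)
      ≤⟨ ℕ.*-monoˡ-≤ (M ℕ.^ (2 ℕ.* suc r)) (ℕ.*-monoʳ-≤ (2 ℕ.^ suc r) 2^l≤) ⟩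
    2 ℕ.^ suc r ℕ.* (2 ℕ.* n ℕ.^ r) ℕ.* M ℕ.^ (2 ℕ.* suc r)
      ≡⟨ solve 3 (λ a b c → a :* (con 2 :* b) :* c := (con 2 :* a) :* c :* b) refl
           (2 ℕ.^ suc r) (n ℕ.^ r) (M ℕ.^ (2 ℕ.* suc r)) ⟩
    2 ℕ.^ suc (suc r) ℕ.* M ℕ.^ (2 ℕ.* suc r) ℕ.* n ℕ.^ r
      ≤⟨ ℕ.*-monoˡ-≤ (n ℕ.^ r) (ℕ.*-monoˡ-≤ (M ℕ.^ (2 ℕ.* suc r)) (ℕ.^-monoˡ-≤ (suc (suc r)) 2≤M)) ⟩
    M ℕ.^ suc (suc r) ℕ.* M ℕ.^ (2 ℕ.* suc r) ℕ.* n ℕ.^ r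
      ≡⟨ cong (ℕ._* n ℕ.^ r) (sym (ℕ.^-distribˡ-+-* M (suc (suc r)) (2 ℕ.* suc r))) ⟩
    M ℕ.^ (suc (suc r) ℕ.+ 2 ℕ.* suc r) ℕ.* n ℕ.^ r ∎)
    (ℕ.≤-trans M^≤ (2^⌊log₂⌋≤ n {{ℕ.>-nonZero (ℕ.≤-trans (s≤s z≤n) 2≤n)}})) ⟩
  n ∎
  where
  open ℕ.≤-Reasoning
  open ℕ-Solver
  L = ⌊log₂ n ⌋
  M = L ℕ.+ (m ℕ.+ d ℕ.+ 2)
  K = 2 ℕ.^ suc l
  P = suc L ℕ.* l ℕ.+ m ℕ.+ d
  2≤M : 2 ℕ.≤ M
  2≤M = ℕ.≤-trans (ℕ.m≤n+m 2 (m ℕ.+ d)) (ℕ.m≤n+m (m ℕ.+ d ℕ.+ 2) L)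
  -- Since 2 ≤ n, the hypothesis on l gives (2^l)^(r + 1) ≤ n^(r + 1), so 2^l ≤ n.
  l≤L : l ℕ.≤ L
  l≤L = subst (ℕ._≤ L) (⌊log₂[2^n]⌋≡n l) (⌊log₂⌋-mono-≤ (^*suc≤⇒≤ r {2 ℕ.^ l} 2^l≤ 2≤n))
  e = m ℕ.+ d
  P+l≤M² : P ℕ.+ l ℕ.≤ M ℕ.^ 2
  P+l≤M² = begin
    suc L ℕ.* l ℕ.+ m ℕ.+ d ℕ.+ l
      ≤⟨ ℕ.+-mono-≤ (ℕ.+-monoˡ-≤ d (ℕ.+-monoˡ-≤ m (ℕ.*-monoʳ-≤ (suc L) l≤L))) l≤L ⟩
    suc L ℕ.* L ℕ.+ m ℕ.+ d ℕ.+ L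
      ≤⟨ ℕ.m≤m+n _ (2 ℕ.* L ℕ.+ 2 ℕ.* L ℕ.* e ℕ.+ e ℕ.* e ℕ.+ 3 ℕ.* e ℕ.+ 4) ⟩
    suc L ℕ.* L ℕ.+ m ℕ.+ d ℕ.+ L ℕ.+ (2 ℕ.* L ℕ.+ 2 ℕ.* L ℕ.* e ℕ.+ e ℕ.* e ℕ.+ 3 ℕ.* e ℕ.+ 4)
      ≡⟨ solve 3 (λ L m d → (con 1 :+ L) :* L :+ m :+ d :+ L
             :+ (con 2 :* L :+ con 2 :* L :* (m :+ d) :+ (m :+ d) :* (m :+ d) :+ con 3 :* (m :+ d) :+ con 4)
           := (L :+ (m :+ d :+ con 2)) :* ((L :+ (m :+ d :+ con 2)) :* con 1)) refl L m d ⟩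
    M ℕ.^ 2 ∎

n^l≤2^ : ∀ n l → n ℕ.^ l ℕ.≤ 2 ℕ.^ (suc ⌊log₂ n ⌋ ℕ.* l)
n^l≤2^ n l = subst (n ℕ.^ l ℕ.≤_) (ℕ.^-*-assoc 2 (suc ⌊log₂ n ⌋) l) (ℕ.^-monoˡ-≤ l (ℕ.<⇒≤ (<2^suc⌊log₂⌋ n)))

skeleton-threshold : ∀ r m d → ∃[ N ] (∀ {n} → N ℕ.≤ n → ∀ l → (2 ℕ.^ l) ℕ.^ suc r ℕ.≤ 2 ℕ.* n ℕ.^ r →
  2 ℕ.^ suc l ℕ.* (suc ⌊log₂ n ⌋ ℕ.* l ℕ.+ m ℕ.+ d) ℕ.+ l ℕ.≤ n)
skeleton-threshold r m d =
  let N , M^≤ = [n+c]^k≤2^n (suc (suc r) ℕ.+ 2 ℕ.* suc r) (m ℕ.+ d ℕ.+ 2)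
  -- n ≥ 2^(N + 1) gives both ⌊log₂ n⌋ ≥ N and n ≥ 2, the latter even when N = 0.
  in 2 ℕ.^ suc N , λ {n} 2^sucN≤n l → skeleton-room r m d n l
       (ℕ.≤-trans (ℕ.^-monoʳ-≤ 2 (s≤s (z≤n {N}))) 2^sucN≤n)
       (M^≤ (ℕ.<⇒≤ (subst (ℕ._≤ ⌊log₂ n ⌋) (⌊log₂[2^n]⌋≡n (suc N)) (⌊log₂⌋-mono-≤ 2^sucN≤n))))

-- From the real hypothesis on l to natural numbers

n/n≡1 : ∀ n → + suc n ℚ./ suc n ≡ 1ℚ
n/n≡1 n = ℚ.toℚᵘ-injective (ℚᵘ.≃-trans (ℚ.toℚᵘ-fromℚᵘ (mkℚᵘ (+ suc n) n)) (*≡* (ℤ.*-comm (+ suc n) 1ℤ)))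

×-1/ : ∀ b d → b × (+ 1 ℚ./ suc d) ≡ + b ℚ./ suc d
×-1/ zero    d = sym (ℚ.0/n≡0 (suc d))
×-1/ (suc b) d = trans (cong (+ 1 ℚ./ suc d ℚ.+_) (×-1/ b d)) (sym (suc-/ b d))

½^n≤1/suc[n] : ∀ n → ½ ^ n ℚ.≤ + 1 ℚ./ suc n
½^n≤1/suc[n] n = begin
  ½ ^ n                        ≡⟨ sym (ℚ.*-identityʳ (½ ^ n)) ⟩
  ½ ^ n ℚ.* 1ℚ                 ≡⟨ cong (½ ^ n ℚ.*_) (sym (trans (×-1/ (suc n) n) (n/n≡1 n))) ⟩
  ½ ^ n ℚ.* (suc n × u)        ≡⟨ trans (×-comm-* (suc n) (½ ^ n) u) (sym (×-assoc-* (suc n) (½ ^ n) u)) ⟩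
  (suc n × (½ ^ n)) ℚ.* u      ≤⟨ ℚ.*-monoʳ-≤-nonNeg u {{ℚ.normalize-nonNeg 1 (suc n)}} (×-monoˡ-≤ (0≤½^ n) (suc≤2^ n)) ⟩
  ((2 ℕ.^ n) × (½ ^ n)) ℚ.* u  ≡⟨ cong (ℚ._* u) (2^a×½^a≡1 n) ⟩
  1ℚ ℚ.* u                     ≡⟨ ℚ.*-identityˡ u ⟩
  u                            ∎
  where
  open ℚ.≤-Reasoning
  u = + 1 ℚ./ suc n

½^-small : ∀ {δ} → 0ℚ ℚ.< δ → ∃[ d ] ½ ^ d ℚ.≤ δ
½^-small 0<δ =
  let d , small = 1/suc-small 0<δ
  in d , ℚ.≤-trans (½^n≤1/suc[n] d) (small ℕ.≤-refl)

1-1/suc : ∀ r → 1ℚ ℚ.- + 1 ℚ./ suc r ≡ + r ℚ./ suc r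
1-1/suc r = trans (cong (ℚ._- u) (trans (sym (n/n≡1 r)) (suc-/ r r)))
  (solve 2 (λ u v → u :+ v :- u := v) refl u (+ r ℚ./ suc r))
  where
  open ℚ-Solver
  u = + 1 ℚ./ suc r

clearDenominators : ∀ l r a i →
  + l ℚ./ 1 ℚ.≤ (+ r ℚ./ suc r) ℚ.* (+ a ℚ./ suc i) ℚ.+ + 1 ℚ./ suc r →
  l ℕ.* suc r ℕ.* suc i ℕ.≤ r ℕ.* a ℕ.+ suc i
-- Unnormalised addition does not reduce: its denominator is `suc r * suc i * suc r`, with one
-- factor `suc r` to cancel.
clearDenominators l r a i l≤ = ℕ.*-cancelʳ-≤ _ _ (suc r) (begin
  l ℕ.* suc r ℕ.* suc i ℕ.* suc r
    ≡⟨ solve 3 (λ l R I → l :* R :* I :* R := l :* (R :* I :* R)) refl l (suc r) (suc i) ⟩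
  l ℕ.* (suc r ℕ.* suc i ℕ.* suc r)
    ≤⟨ ℤ.drop‿+≤+ (subst₂ ℤ._≤_ (sym (ℤ.pos-* l (suc r ℕ.* suc i ℕ.* suc r))) numerator (ℚᵘ.drop-*≤* unnormalised)) ⟩
  (r ℕ.* a ℕ.* suc r ℕ.+ 1 ℕ.* (suc r ℕ.* suc i)) ℕ.* 1
    ≡⟨ solve 4 (λ r a R I → (r :* a :* R :+ con 1 :* (R :* I)) :* con 1 := (r :* a :+ I) :* R) refl r a (suc r) (suc i) ⟩
  (r ℕ.* a ℕ.+ suc i) ℕ.* suc r ∎)
  where
  open ℕ.≤-Reasoning
  open ℕ-Solver
  unnormalised : mkℚᵘ (+ l) 0 ℚᵘ.≤ mkℚᵘ (+ r) r ℚᵘ.* mkℚᵘ (+ a) i ℚᵘ.+ mkℚᵘ (+ 1) r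
  unnormalised = ℚᵘ.≤-respˡ-≃ (ℚ.toℚᵘ-fromℚᵘ (mkℚᵘ (+ l) 0)) (ℚᵘ.≤-respʳ-≃
    (ℚᵘ.≃-trans (ℚ.toℚᵘ-homo-+ ((+ r ℚ./ suc r) ℚ.* (+ a ℚ./ suc i)) (+ 1 ℚ./ suc r)) (ℚᵘ.+-cong
      (ℚᵘ.≃-trans (ℚ.toℚᵘ-homo-* (+ r ℚ./ suc r) (+ a ℚ./ suc i))
        (ℚᵘ.*-cong (ℚ.toℚᵘ-fromℚᵘ (mkℚᵘ (+ r) r)) (ℚ.toℚᵘ-fromℚᵘ (mkℚᵘ (+ a) i))))
      (ℚ.toℚᵘ-fromℚᵘ (mkℚᵘ (+ 1) r))))
    (ℚ.toℚᵘ-mono-≤ l≤))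
  numerator : ((+ r ℤ.* + a) ℤ.* + suc r ℤ.+ + 1 ℤ.* + (suc r ℕ.* suc i)) ℤ.* + 1 ≡
              + ((r ℕ.* a ℕ.* suc r ℕ.+ 1 ℕ.* (suc r ℕ.* suc i)) ℕ.* 1)
  numerator = sym (trans (ℤ.pos-* (r ℕ.* a ℕ.* suc r ℕ.+ 1 ℕ.* (suc r ℕ.* suc i)) 1) (cong (ℤ._* + 1) (trans (ℤ.pos-+ (r ℕ.* a ℕ.* suc r) (1 ℕ.* (suc r ℕ.* suc i)))
    (cong₂ ℤ._+_ (trans (ℤ.pos-* (r ℕ.* a) (suc r)) (cong (ℤ._* + suc r) (ℤ.pos-* r a))) (ℤ.pos-* 1 (suc r ℕ.* suc i))))))

-- Exponentiating with base 2, using 2^a ≤ n^(i + 1) and taking an (i + 1)-th root eliminates the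
-- approximation index i; the additive error `suc i` becomes the factor 2.
root : ∀ l r i n .{{_ : NonZero n}} →
  l ℕ.* suc r ℕ.* suc i ℕ.≤ r ℕ.* ⌊log₂ (n ℕ.^ suc i) ⌋ ℕ.+ suc i →
  (2 ℕ.^ l) ℕ.^ suc r ℕ.≤ 2 ℕ.* n ℕ.^ r
root l r i n bound = ^-cancelˡ-≤ i (begin
  ((2 ℕ.^ l) ℕ.^ suc r) ℕ.^ suc i
    ≡⟨ trans (cong (ℕ._^ suc i) (ℕ.^-*-assoc 2 l (suc r))) (ℕ.^-*-assoc 2 (l ℕ.* suc r) (suc i)) ⟩
  2 ℕ.^ (l ℕ.* suc r ℕ.* suc i)
    ≤⟨ ℕ.^-monoʳ-≤ 2 bound ⟩
  2 ℕ.^ (r ℕ.* a ℕ.+ suc i)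
    ≡⟨ ℕ.^-distribˡ-+-* 2 (r ℕ.* a) (suc i) ⟩
  2 ℕ.^ (r ℕ.* a) ℕ.* 2 ℕ.^ suc i
    ≡⟨ cong (ℕ._* 2 ℕ.^ suc i) (trans (cong (2 ℕ.^_) (ℕ.*-comm r a)) (sym (ℕ.^-*-assoc 2 a r))) ⟩
  (2 ℕ.^ a) ℕ.^ r ℕ.* 2 ℕ.^ suc i
    ≤⟨ ℕ.*-monoˡ-≤ (2 ℕ.^ suc i) (ℕ.^-monoˡ-≤ r (2^⌊log₂⌋≤ (n ℕ.^ suc i) {{ℕ.m^n≢0 n (suc i)}})) ⟩
  (n ℕ.^ suc i) ℕ.^ r ℕ.* 2 ℕ.^ suc i
    ≡⟨ cong (ℕ._* 2 ℕ.^ suc i) (trans (ℕ.^-*-assoc n (suc i) r)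
         (trans (cong (n ℕ.^_) (ℕ.*-comm (suc i) r)) (sym (ℕ.^-*-assoc n r (suc i))))) ⟩
  (n ℕ.^ r) ℕ.^ suc i ℕ.* 2 ℕ.^ suc i
    ≡⟨ trans (sym (^-distribʳ-* (n ℕ.^ r) 2 (suc i))) (cong (ℕ._^ suc i) (ℕ.*-comm (n ℕ.^ r) 2)) ⟩
  (2 ℕ.* n ℕ.^ r) ℕ.^ suc i ∎)
  where
  open ℕ.≤-Reasoning
  a = ⌊log₂ (n ℕ.^ suc i) ⌋

integer-bound-at : ∀ m .{{_ : NonZero m}} {e} r → + 1 ℚ./ suc r ℚ.≤ e ℚ.* (1ℤ ℚ./ m) →
  ∀ n .{{_ : NonZero n}} l i →
  + l ℚ./ 1 ℚ.≤ (1ℚ ℚ.- e ℚ.* (1ℤ ℚ./ m)) ℚ.* log₂-approx n i ℚ.+ + 1 ℚ./ suc r →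
  (2 ℕ.^ l) ℕ.^ suc r ℕ.≤ 2 ℕ.* n ℕ.^ r
integer-bound-at m {e} r u≤ n l i l≤ = root l r i n (clearDenominators l r a i (begin
  + l ℚ./ 1
    ≤⟨ l≤ ⟩
  (1ℚ ℚ.- e ℚ.* (1ℤ ℚ./ m)) ℚ.* (+ a ℚ./ suc i) ℚ.+ u
    ≤⟨ ℚ.+-monoˡ-≤ u (ℚ.*-monoʳ-≤-nonNeg (+ a ℚ./ suc i) {{ℚ.normalize-nonNeg a (suc i)}}
         (ℚ.+-monoʳ-≤ 1ℚ (ℚ.neg-antimono-≤ u≤))) ⟩
  (1ℚ ℚ.- u) ℚ.* (+ a ℚ./ suc i) ℚ.+ u
    ≡⟨ cong (λ p → p ℚ.* (+ a ℚ./ suc i) ℚ.+ u) (1-1/suc r) ⟩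
  (+ r ℚ./ suc r) ℚ.* (+ a ℚ./ suc i) ℚ.+ u ∎))
  where
  open ℚ.≤-Reasoning
  u = + 1 ℚ./ suc r
  a = ⌊log₂ (n ℕ.^ suc i) ⌋

-- The conclusion is the exponential form of (r + 1) l ≤ r log₂ n + 1. A single number 1 / (r + 1) ≤
-- δ / m serves both as an eventual lower bound for ε / m and as the slack in `_≤ᴿ_`. It depends on
-- ε and m alone, so r is uniform in n and l.
integer-bound : ∀ m .{{_ : NonZero m}} ε → 0ᴿ <ᴿ ε →
  ∃[ r ] (∀ n .{{_ : NonZero n}} l → fromℤ (+ l) ≤ᴿ (1ᴿ -ᴿ ε /ᴿ m) *ᴿ log₂ n →
          (2 ℕ.^ l) ℕ.^ suc r ℕ.≤ 2 ℕ.* n ℕ.^ r)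
integer-bound m ε (δ , 0<δ , N , δ≤ε) =
  let r , u≤δ/m = 1/suc-small 0<δ/m
  in r , λ n l l≤ →
    let M , l≤ᵢ = l≤ (ℚ.positive⁻¹ (+ 1 ℚ./ suc r) {{ℚ.normalize-pos 1 (suc r)}})
    -- The index `N ⊔ M` is late enough both for ε to be at least δ and for the inequality on l to
    -- hold within its slack.
    in integer-bound-at m {approx ε (N ℕ.⊔ M)} r
         (ℚ.≤-trans (u≤δ/m ℕ.≤-refl) (ℚ.*-monoʳ-≤-nonNeg (1ℤ ℚ./ m) {{ℚ.normalize-nonNeg 1 m}}
           (subst (ℚ._≤ approx ε (N ℕ.⊔ M)) (ℚ.+-identityˡ δ) (δ≤ε (ℕ.m≤m⊔n N M)))))
         n l (N ℕ.⊔ M) (l≤ᵢ (ℕ.m≤n⊔m N M))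
  where
  0<δ/m : 0ℚ ℚ.< δ ℚ.* (1ℤ ℚ./ m)
  0<δ/m = ℚ.positive⁻¹ (δ ℚ.* (1ℤ ℚ./ m))
    {{ℚ.pos*pos⇒pos δ {{ℚ.positive 0<δ}} (1ℤ ℚ./ m) {{ℚ.normalize-pos 1 m}}}}

-- Asymptotic vanishing of the homology

neighbourhoods⇒vanishing : ∀ n m {δ} l → (∀ {k} → l ≡ + k → 𝔼 G⟨ suc n , ½ ⟩ (defect m k) ℚ.≤ δ) → 0ℚ ℚ.≤ δ →
  Pr[ G⟨ suc n , ½ ⟩ , (λ G → IsTrivial (H̃ (multineighborComplex m G) (l - + 2))) ]≥ (1ℚ ℚ.- δ)
neighbourhoods⇒vanishing n m {δ} (+ k) small 0≤δ =
    (λ G → ⌊ defect m k G ℚ.<? 1ℚ ⌋)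
  , (λ G defect<1 → H̃-trivial m G (+ k) λ { σ refl →
      defect<1⇒m≤∣commonNeighbours∣ m G σ (toWitness defect<1) })
  , ℚ.≤-trans (ℚ.+-monoʳ-≤ 1ℚ (ℚ.neg-antimono-≤ (small refl)))
      (markov (G-isProbability (suc n)) λ G → Σ-nonNeg (subsetsOfSize (suc n) k) (0≤defectTerm m G))
-- No set has a negative number of elements, so the condition on common neighbours is vacuous and
-- the sure event serves.
neighbourhoods⇒vanishing n m {δ} ℤ.-[1+ k ] small 0≤δ =
    (λ _ → true)
  , (λ G _ → H̃-trivial m G ℤ.-[1+ k ] λ _ ())
  , (begin
      1ℚ ℚ.- δ                        ≤⟨ ℚ.+-monoʳ-≤ 1ℚ (ℚ.neg-antimono-≤ 0≤δ) ⟩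
      1ℚ                              ≡⟨ sym (𝔼-const (G-isProbability (suc n)) 1ℚ) ⟩
      𝔼 G⟨ suc n , ½ ⟩ (λ _ → 1ℚ)     ≡⟨ sym (Pr≡𝔼 G⟨ suc n , ½ ⟩ (λ _ → true)) ⟩
      Pr G⟨ suc n , ½ ⟩ (λ _ → true)  ∎)
  where open ℚ.≤-Reasoning

proposition1 : (m : ℕ) .{{_ : NonZero m}} (ε : ℝ) → 0ᴿ <ᴿ ε →
    (l : ℕ → ℤ) →
    (∀ n .{{_ : NonZero n}} → fromℤ (l n) ≤ᴿ (1ᴿ -ᴿ ε /ᴿ m) *ᴿ log₂ n) →
    AAS (λ n → G⟨ n , ½ ⟩) (λ n G → IsTrivial (H̃ (multineighborComplex m G) (l n - + 2)))
proposition1 m ε 0<ε l l≤ 0<δ =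
  let r , bound     = integer-bound m ε 0<ε
      d , ½^d≤δ     = ½^-small 0<δ
      N , threshold = skeleton-threshold r m d
  -- `suc N` excludes the graph without vertices: `log₂` and the apex of the cone need a vertex.
  in suc N , λ { {suc n} N<n → neighbourhoods⇒vanishing n m (l (suc n))
       (λ {k} l≡k →
         let 2^k≤ = bound (suc n) k (subst (λ i → fromℤ i ≤ᴿ (1ᴿ -ᴿ ε /ᴿ m) *ᴿ log₂ (suc n)) l≡k (l≤ (suc n)))
         -- The exponent for the number of k-sets comes from rounding log₂ of the vertex count up to
         -- `suc ⌊log₂ suc n ⌋`.
         in ℚ.≤-trans (𝔼-defect-small (suc n) m k (suc ⌊log₂ suc n ⌋ ℕ.* k) d
                        (n^l≤2^ (suc n) k) (threshold (ℕ.<⇒≤ N<n) k 2^k≤))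
                      ½^d≤δ)
       (ℚ.<⇒≤ 0<δ) }
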